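{- Let $\Pi_q$ be a projective plane (not necessarily Desarguesian) of order $q$, and let $s_\mu(2,q)$ denote the smallest size of a $(1,\mu)$-saturating set in $\Pi_q$. Then \[ s_{2}(2,q) \leq 2.4\sqrt{(q+1)\ln (q+1)}+2 \quad\text{for } q\geq 97; \] \[ s_{3}(2,q) \leq 2.6\sqrt{(q+1)\ln (q+1)}+2 \quad\text{for } q\geq 181; \] \[ s_{4}(2,q) \leq 2.8\sqrt{(q+1)\ln (q+1)}+2 \quad\text{for } q\geq 125. \]
   Context: Let $\Pi_q$ be a projective plane of order $q$. A point set $S\subset\Pi_q$ is $(1,\mu)$-saturating if for every point $Q\in\Pi_q\setminus S$ the number of secants of $S$ through $Q$, counted with multiplicity, is at least $\mu$, where a line $\ell$ through $Q$ is counted with multiplicity $\binom{\#(\ell\cap S)}{2}$. -}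

module Defs where

open import Data.Nat using (ℕ; zero; suc; _+_; _*_; _∸_; _^_; _≤_; _!)
open import Data.Nat.Combinatorics using (_C_)
open import Data.Bool using (Bool; true; false; if_then_else_)
open import Data.Fin using (Fin; zero; suc)
open import Data.Fin.Subset using (Subset; _∉_; _∩_; ∣_∣)
open import Data.Vec using (tabulate)
open import Data.Empty using (⊥)
open import Data.Product using (Σ; ∃; _×_; _,_)
open import Relation.Binary.PropositionalEquality using (_≡_; _≢_)

sumFin : (n : ℕ) → (Fin n → ℕ) → ℕ
sumFin zero    f = 0
sumFin (suc n) f = f zero + sumFin n (λ i → f (suc i))

record ProjectivePlane (q : ℕ) : Set where
  field
    nP nL : ℕ
    I     : Fin nP → Fin nL → Bool
  pointsOn : Fin nL → Subset nP
  pointsOn ℓ = tabulate (λ P → I P ℓ)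
  Collinear : Fin nP → Fin nP → Fin nP → Set
  Collinear P Q R = ∃ λ ℓ → I P ℓ ≡ true × I Q ℓ ≡ true × I R ℓ ≡ true
  field
    joinUnique : ∀ P Q → P ≢ Q → ∃ λ ℓ → I P ℓ ≡ true × I Q ℓ ≡ true ×
                   (∀ m → I P m ≡ true → I Q m ≡ true → m ≡ ℓ)
    meetUnique : ∀ ℓ m → ℓ ≢ m → ∃ λ P → I P ℓ ≡ true × I P m ≡ true ×
                   (∀ R → I R ℓ ≡ true → I R m ≡ true → R ≡ P)
    quadrangle : Σ (Fin nP) λ A → Σ (Fin nP) λ B → Σ (Fin nP) λ C′ → Σ (Fin nP) λ D →
                   (Collinear A B C′ → ⊥) × (Collinear A B D → ⊥) ×
                   (Collinear A C′ D → ⊥) × (Collinear B C′ D → ⊥)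
    -- order q: some (hence every) line has exactly q+1 points
    order : ∃ λ ℓ → ∣ pointsOn ℓ ∣ ≡ suc q

open ProjectivePlane public

-- (1,μ)-saturating: every point Q outside S lies on secants of total
-- multiplicity ≥ μ, a line ℓ ∋ Q counting (#(ℓ ∩ S) choose 2).
Saturating : ∀ {q} (Π : ProjectivePlane q) → ℕ → Subset (nP Π) → Set
Saturating Π μ S = ∀ Q → Q ∉ S →
  μ ≤ sumFin (nL Π) (λ ℓ → if I Π Q ℓ then (∣ S ∩ pointsOn Π ℓ ∣ C 2) else 0)

-- expNumer a n = n! * Σ_{k=0}^{n} a^k / k!   (a natural number)
expNumer : ℕ → ℕ → ℕ
expNumer a zero    = 1
expNumer a (suc n) = suc n * expNumer a n + a ^ suc n

-- ExpLe a Y  ⟺  e^a ≤ Y  (the partial sums of the exponential series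
-- increase to e^a, so e^a ≤ Y iff every partial sum is ≤ Y)
ExpLe : ℕ → ℕ → Set
ExpLe a Y = ∀ n → expNumer a n ≤ Y * (n !)

-- BoundOK c₁ c₂ s q  ⟺  s ≤ (c₁/c₂) * sqrt((q+1) ln(q+1)) + 2   (real inequality)
-- Derivation: trivially true if s ≤ 2; otherwise equivalent to
--   c₂²(s-2)² / (c₁²(q+1)) ≤ ln(q+1)  ⟺  e^{c₂²(s-2)²} ≤ (q+1)^{c₁²(q+1)}.
-- When s ≤ 2 the right side below is e^0 = 1 ≤ (q+1)^…, also true.
BoundOK : ℕ → ℕ → ℕ → ℕ → Set
BoundOK c₁ c₂ s q =
  ExpLe (c₂ * c₂ * ((s ∸ 2) * (s ∸ 2))) (suc q ^ (c₁ * c₁ * suc q))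

{-# OPTIONS --safe #-}
module Submission where

-- Points are added greedily, starting from 3 + μ arbitrary ones.  A point Q ∉ S lying on secants of
-- total multiplicity x < μ carries the weight a^{μ-1-x}.  The points of S lie on at least |S| - x
-- lines through Q, and a new point on one of these lines raises the multiplicity of Q; averaging over
-- the new point multiplies the total weight by at most 1 - (1 - 1/a)(|S| - μ + 1)/(q + 3).
-- By AM-GM these factors can be replaced by their mean, and 1 - y ≤ (1 - y/2 - y²/8)² ≤ e^{-y-y²/4}
-- shows that at the claimed size the total weight, initially at most a^{μ-1}(q + 1)², is below 1.
-- It is a natural number, so it vanishes and S is (1,μ)-saturating.
--
-- Instead of logarithms, everything is compared with powers of β = 1 + 1/k, where β^k ≤ e ≤ β^{k+1}
-- and k = 200.

-- A point must be hit up to μ times. Geometric weights make the expected loss per step independent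
-- of the hits a point already has, so all unsaturated points obey the same linear recursion. A
-- larger a makes every hit count for more but costs a^{μ-1} at the start. If X is the sum of the
-- rates (|S| - μ + 1)/(q + 3) over all steps, then (1 - 1/a) X - (μ-1) ln a is greatest at a =
-- X/(μ-1); at the least admissible q this is close to 13, 9 and 6 for μ = 2, 3, 4.
--
-- The bounds are claimed from explicit values of q on, so there is no asymptotic slack. The extra
-- y²/4 closes this gap. What then remains is a polynomial inequality in q and the number of steps,
-- and the value k = 200 keeps the loss from replacing e by powers of β within its margin.

open import Defs
open import Data.Bool using (Bool; true; false; if_then_else_; _∧_)
open import Data.Bool.Properties using (¬-not)
open import Data.Empty using (⊥; ⊥-elim)
open import Data.Fin using (Fin; zero; suc)
import Data.Fin.Properties as Fin
open import Data.Fin.Subset using (Subset; _∩_; ∣_∣) renaming (⊤ to full)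
open import Data.Fin.Subset.Properties using (∈⊤; ∣⊤∣≡n)
open import Data.List using (List; []; _∷_; _++_; length; replicate)
open import Data.List.Properties using (length-++; length-replicate)
open import Data.Nat
open import Data.Nat.Combinatorics using (_C_; nC1≡n; nCk+nC[k+1]≡[n+1]C[k+1])
open import Data.Nat.ListAction using (sum; product)
open import Data.Nat.ListAction.Properties using (sum-++; product-++)
open import Data.Nat.Properties
open import Data.Nat.Tactic.RingSolver using (solve-∀)
open import Data.Product using (∃; _×_; _,_; proj₁; proj₂)
open import Data.Sum using (_⊎_; inj₁; inj₂)
open import Data.Vec using ([]; _∷_; lookup; _[_]≔_)
open import Data.Vec.Properties using (lookup-zipWith; lookup∘tabulate; lookup∘update; lookup∘update′; []≔-lookup; lookup⇒[]=)
open import Function using (_∘_)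
open import Relation.Binary.PropositionalEquality
open import Relation.Nullary using (¬_; Dec; yes; no)
open import Relation.Unary using (Decidable)

-- AM-GM and the exponential function

^-distribʳ-* : ∀ m n o → (m * n) ^ o ≡ m ^ o * n ^ o
^-distribʳ-* m n zero    = refl
^-distribʳ-* m n (suc o) =
  trans (cong (m * n *_) (^-distribʳ-* m n o)) (interchange m n (m ^ o) (n ^ o))
  where
  interchange : ∀ a b c d → a * b * (c * d) ≡ a * c * (b * d)
  interchange = solve-∀

2mn≤m²+n² : ∀ m n → 2 * (m * n) ≤ m * m + n * n
2mn≤m²+n² m n with ≤-total m n
... | inj₁ m≤n with d , refl ← m≤n⇒∃[o]m+o≡n m≤n = m+n≤o⇒m≤o _ (≤-reflexive (eq m d))
  where
  eq : ∀ m d → 2 * (m * (m + d)) + d * d ≡ m * m + (m + d) * (m + d)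
  eq = solve-∀
... | inj₂ n≤m with d , refl ← m≤n⇒∃[o]m+o≡n n≤m = m+n≤o⇒m≤o _ (≤-reflexive (eq n d))
  where
  eq : ∀ n d → 2 * ((n + d) * n) + d * d ≡ (n + d) * (n + d) + n * n
  eq = solve-∀

-- Bernoulli's inequality for y / x, with the denominator cleared.
bernoulli : ∀ n x y → suc n * (y * x ^ n) ≤ y ^ suc n + n * x ^ suc n
bernoulli zero    x y = ≤-reflexive (eq y)
  where
  eq : ∀ y → 1 * (y * 1) ≡ y * 1 + 0
  eq = solve-∀
bernoulli (suc n) x y = +-cancelʳ-≤ (n * (y * (x * x ^ n))) _ _ (begin
  suc (suc n) * (y * (x * x ^ n)) + n * (y * (x * x ^ n))
    ≡⟨ eq₁ n x y (x ^ n) ⟩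
  suc n * x ^ n * (2 * (y * x))
    ≤⟨ *-monoʳ-≤ (suc n * x ^ n) (2mn≤m²+n² y x) ⟩
  suc n * x ^ n * (y * y + x * x)
    ≡⟨ eq₂ n x y (x ^ n) ⟩
  y * (suc n * (y * x ^ n)) + suc n * (x * (x * x ^ n))
    ≤⟨ +-monoˡ-≤ _ (*-monoʳ-≤ y (bernoulli n x y)) ⟩
  y * (y ^ suc n + n * x ^ suc n) + suc n * (x * (x * x ^ n))
    ≡⟨ eq₃ n x y (y ^ suc n) (x ^ n) ⟩
  y * y ^ suc n + suc n * (x * (x * x ^ n)) + n * (y * (x * x ^ n)) ∎)
  where
  open ≤-Reasoning
  eq₁ : ∀ n x y p → suc (suc n) * (y * (x * p)) + n * (y * (x * p)) ≡ suc n * p * (2 * (y * x))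
  eq₁ = solve-∀
  eq₂ : ∀ n x y p → suc n * p * (y * y + x * x) ≡ y * (suc n * (y * p)) + suc n * (x * (x * p))
  eq₂ = solve-∀
  eq₃ : ∀ n x y r p → y * (r + n * (x * p)) + suc n * (x * (x * p))
                      ≡ y * r + suc n * (x * (x * p)) + n * (y * (x * p))
  eq₃ = solve-∀

-- Bernoulli's inequality for `suc n * s` and `n * (s + y)`, which agree exactly when y is the mean
-- s / n of the n earlier entries.
amgm-step : ∀ n s y → suc n ^ suc n * s ^ n * y ≤ n ^ n * (s + y) ^ suc n
amgm-step zero      s y = m+n≤o⇒m≤o _ (≤-reflexive (eq₀ s y))
  where
  eq₀ : ∀ s y → 1 * 1 * y + s ≡ 1 * ((s + y) * 1)
  eq₀ = solve-∀
amgm-step n@(suc _) s y = *-cancelˡ-≤ n (+-cancelʳ-≤ (n * (suc n * s) ^ suc n) _ _ (begin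
  n * (suc n ^ suc n * s ^ n * y) + n * (suc n * s) ^ suc n
    ≡⟨ cong (λ w → n * (suc n ^ suc n * s ^ n * y) + n * w) (^-distribʳ-* (suc n) s (suc n)) ⟩
  n * (suc n * suc n ^ n * s ^ n * y) + n * (suc n * suc n ^ n * (s * s ^ n))
    ≡⟨ eq₁ n s y (suc n ^ n) (s ^ n) ⟩
  suc n * (n * (s + y) * (suc n ^ n * s ^ n))
    ≡⟨ cong (λ w → suc n * (n * (s + y) * w)) (^-distribʳ-* (suc n) s n) ⟨
  suc n * (n * (s + y) * (suc n * s) ^ n)
    ≤⟨ bernoulli n (suc n * s) (n * (s + y)) ⟩
  (n * (s + y)) ^ suc n + n * (suc n * s) ^ suc n
    ≡⟨ cong (_+ n * (suc n * s) ^ suc n)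
         (trans (^-distribʳ-* n (s + y) (suc n)) (*-assoc n (n ^ n) ((s + y) ^ suc n))) ⟩
  n * (n ^ n * (s + y) ^ suc n) + n * (suc n * s) ^ suc n ∎))
  where
  open ≤-Reasoning
  eq₁ : ∀ n s y p r → n * (suc n * p * r * y) + n * (suc n * p * (s * r))
                      ≡ suc n * (n * (s + y) * (p * r))
  eq₁ = solve-∀

n^n≢0 : ∀ n → NonZero (n ^ n)
n^n≢0 zero    = _
n^n≢0 (suc n) = m^n≢0 (suc n) (suc n)

am-gm : ∀ xs → product xs * length xs ^ length xs ≤ sum xs ^ length xs
am-gm []       = ≤-refl
am-gm (x ∷ xs) = *-cancelˡ-≤ (n ^ n) {{n^n≢0 n}} (begin
  n ^ n * (x * product xs * suc n ^ suc n)
    ≡⟨ eq (n ^ n) x (product xs) (suc n ^ suc n) ⟩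
  suc n ^ suc n * (product xs * n ^ n) * x
    ≤⟨ *-monoˡ-≤ x (*-monoʳ-≤ (suc n ^ suc n) (am-gm xs)) ⟩
  suc n ^ suc n * sum xs ^ n * x
    ≤⟨ amgm-step n (sum xs) x ⟩
  n ^ n * (sum xs + x) ^ suc n
    ≡⟨ cong (λ s → n ^ n * s ^ suc n) (+-comm (sum xs) x) ⟩
  n ^ n * (x + sum xs) ^ suc n ∎)
  where
  open ≤-Reasoning
  n = length xs
  eq : ∀ p x r s → p * (x * r * s) ≡ s * (r * p) * x
  eq = solve-∀

product-replicate : ∀ n x → product (replicate n x) ≡ x ^ n
product-replicate zero    x = refl
product-replicate (suc n) x = cong (x *_) (product-replicate n x)

sum-replicate : ∀ n x → sum (replicate n x) ≡ n * x
sum-replicate zero    x = refl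
sum-replicate (suc n) x = cong (x +_) (sum-replicate n x)

weighted-am-gm : ∀ m n x y → x ^ m * y ^ n * (m + n) ^ (m + n) ≤ (m * x + n * y) ^ (m + n)
weighted-am-gm m n x y =
  subst₂ _≤_ (cong₂ (λ p l → p * l ^ l) prod len) (cong₂ _^_ total len) (am-gm xs)
  where
  xs = replicate m x ++ replicate n y
  len : length xs ≡ m + n
  len = trans (length-++ (replicate m x)) (cong₂ _+_ (length-replicate m) (length-replicate n))
  prod : product xs ≡ x ^ m * y ^ n
  prod = trans (product-++ (replicate m x) _) (cong₂ _*_ (product-replicate m x) (product-replicate n y))
  total : sum xs ≡ m * x + n * y
  total = trans (sum-++ (replicate m x) _) (cong₂ _+_ (sum-replicate m x) (sum-replicate n y))

-- (1 - u/w)^w (1 + 1/k)^{uk} ≤ 1 for w = v + u: the average of w copies of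
-- 1 - u/w and uk copies of 1 + 1/k is 1.
exp-lower : ∀ k .{{_ : NonZero k}} v u .{{_ : NonZero (v + u)}} →
            v ^ (v + u) * suc k ^ (u * k) ≤ (v + u) ^ (v + u) * k ^ (u * k)
exp-lower k v u = *-cancelˡ-≤ (k ^ w * w ^ n) {{m*n≢0 _ _ {{m^n≢0 k w}} {{m^n≢0 w n}}}}
  (*-cancelʳ-≤ _ _ ((w + n) ^ (w + n)) {{n^n≢0 (w + n)}} (begin
  k ^ w * w ^ n * (v ^ w * suc k ^ n) * (w + n) ^ (w + n)
    ≡⟨ cong (_* (w + n) ^ (w + n)) (eq₁ (k ^ w) (w ^ n) (v ^ w) (suc k ^ n)) ⟩
  v ^ w * k ^ w * (w ^ n * suc k ^ n) * (w + n) ^ (w + n)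
    ≡⟨ cong (_* (w + n) ^ (w + n)) (cong₂ _*_ (^-distribʳ-* v k w) (^-distribʳ-* w (suc k) n)) ⟨
  (v * k) ^ w * (w * suc k) ^ n * (w + n) ^ (w + n)
    ≤⟨ weighted-am-gm w n (v * k) (w * suc k) ⟩
  (w * (v * k) + n * (w * suc k)) ^ (w + n)
    ≡⟨ cong (_^ (w + n)) (eq₂ k v u) ⟩
  (w * k * (w + n)) ^ (w + n)
    ≡⟨ ^-distribʳ-* (w * k) (w + n) (w + n) ⟩
  (w * k) ^ (w + n) * (w + n) ^ (w + n)
    ≡⟨ cong (_* (w + n) ^ (w + n)) (begin-equality
         (w * k) ^ (w + n)                 ≡⟨ ^-distribˡ-+-* (w * k) w n ⟩
         (w * k) ^ w * (w * k) ^ n         ≡⟨ cong₂ _*_ (^-distribʳ-* w k w) (^-distribʳ-* w k n) ⟩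
         w ^ w * k ^ w * (w ^ n * k ^ n)   ≡⟨ eq₃ (w ^ w) (k ^ w) (w ^ n) (k ^ n) ⟩
         k ^ w * w ^ n * (w ^ w * k ^ n)   ∎) ⟩
  k ^ w * w ^ n * (w ^ w * k ^ n) * (w + n) ^ (w + n) ∎))
  where
  open ≤-Reasoning
  w = v + u
  n = u * k
  eq₁ : ∀ a b c d → a * b * (c * d) ≡ c * a * (b * d)
  eq₁ = solve-∀
  eq₂ : ∀ k v u → (v + u) * (v * k) + u * k * ((v + u) * suc k) ≡ (v + u) * k * (v + u + u * k)
  eq₂ = solve-∀
  eq₃ : ∀ a b c d → a * b * (c * d) ≡ b * c * (a * d)
  eq₃ = solve-∀

-- scaledExp L n y = n! Lⁿ Σ_{i ≤ n} (y/L)ⁱ / i!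
scaledExp : ℕ → ℕ → ℕ → ℕ
scaledExp L zero    y = 1
scaledExp L (suc n) y = suc n * (L * scaledExp L n y) + y ^ suc n

-- The mean value inequality for the partial sums of the exponential series.
scaledExp-step : ∀ L n y →
  scaledExp L (suc n) (suc y) ≤ scaledExp L (suc n) y + suc n * scaledExp L n (suc y)
scaledExp-step L n y = begin
  suc n * (L * scaledExp L n (suc y)) + suc y ^ suc n
    ≤⟨ +-mono-≤ (*-monoʳ-≤ (suc n) (ih n)) power ⟩
  suc n * (L * scaledExp L n y + lower n) + (y ^ suc n + suc n * suc y ^ n)
    ≡⟨ eq₁ (suc n) (L * scaledExp L n y) (lower n) (y ^ suc n) (suc y ^ n) ⟩
  suc n * (L * scaledExp L n y) + y ^ suc n + suc n * (lower n + suc y ^ n)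
    ≡⟨ cong (λ s → scaledExp L (suc n) y + suc n * s) (lower-eq n) ⟩
  scaledExp L (suc n) y + suc n * scaledExp L n (suc y) ∎
  where
  open ≤-Reasoning
  -- `lower n` is `scaledExp L n (suc y)` without its top term, so that the induction hypothesis and
  -- the estimate for the top power recombine.
  lower : ℕ → ℕ
  lower zero    = 0
  lower (suc n) = suc n * (L * scaledExp L n (suc y))
  lower-eq : ∀ n → lower n + suc y ^ n ≡ scaledExp L n (suc y)
  lower-eq zero    = refl
  lower-eq (suc n) = refl
  ih : ∀ n → L * scaledExp L n (suc y) ≤ L * scaledExp L n y + lower n
  ih zero    = ≤-reflexive (sym (+-identityʳ _))
  ih (suc n) = ≤-trans (*-monoʳ-≤ L (scaledExp-step L n y))
    (≤-reflexive (eq₂ L (scaledExp L (suc n) y) (suc n) (scaledExp L n (suc y))))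
    where
    eq₂ : ∀ L a n b → L * (a + n * b) ≡ L * a + n * (L * b)
    eq₂ = solve-∀
  eq₁ : ∀ n a b c d → n * (a + b) + (c + n * d) ≡ n * a + c + n * (b + d)
  eq₁ = solve-∀
  power : suc y ^ suc n ≤ y ^ suc n + suc n * suc y ^ n
  power = +-cancelʳ-≤ (n * suc y ^ suc n) _ _ (begin
    suc y ^ suc n + n * suc y ^ suc n
      ≡⟨ eq₃ n y (suc y ^ n) ⟩
    suc n * (y * suc y ^ n) + suc n * suc y ^ n
      ≤⟨ +-monoˡ-≤ _ (bernoulli n (suc y) y) ⟩
    y ^ suc n + n * suc y ^ suc n + suc n * suc y ^ n
      ≡⟨ eq₄ (y ^ suc n) (n * suc y ^ suc n) (suc n * suc y ^ n) ⟩
    y ^ suc n + suc n * suc y ^ n + n * suc y ^ suc n ∎)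
    where
    eq₃ : ∀ n y p → suc y * p + n * (suc y * p) ≡ suc n * (y * p) + suc n * p
    eq₃ = solve-∀
    eq₄ : ∀ a b c → a + b + c ≡ a + c + b
    eq₄ = solve-∀

-- Enlarging the shorter partial sum in the mean value inequality to the full one gives (1 -
-- 1/(k+1)) E(y+1) ≤ E(y): increasing the argument by 1/(k+1) costs a factor of at most 1 + 1/k.
scaledExp-decay : ∀ k n y → k * scaledExp (suc k) n (suc y) ≤ suc k * scaledExp (suc k) n y
scaledExp-decay k zero    y = *-monoˡ-≤ 1 (n≤1+n k)
scaledExp-decay k (suc n) y = +-cancelˡ-≤ (E (suc n) (suc y)) _ _ (begin
  E (suc n) (suc y) + k * E (suc n) (suc y)
    ≤⟨ *-monoʳ-≤ (suc k) (scaledExp-step (suc k) n y) ⟩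
  suc k * (E (suc n) y + suc n * E n (suc y))
    ≡⟨ eq (suc k) (E (suc n) y) (suc n) (E n (suc y)) ⟩
  suc n * (suc k * E n (suc y)) + suc k * E (suc n) y
    ≤⟨ +-monoˡ-≤ (suc k * E (suc n) y) (m≤m+n (suc n * (suc k * E n (suc y))) (suc y ^ suc n)) ⟩
  E (suc n) (suc y) + suc k * E (suc n) y ∎)
  where
  open ≤-Reasoning
  E = scaledExp (suc k)
  eq : ∀ L a n b → L * (a + n * b) ≡ n * (L * b) + L * a
  eq = solve-∀

scaledExp-bound : ∀ k n y →
  scaledExp (suc k) n y * k ^ y ≤ suc k ^ y * scaledExp (suc k) n 0
scaledExp-bound k n zero    = ≤-reflexive (*-comm (scaledExp (suc k) n 0) 1)
scaledExp-bound k n (suc y) = begin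
  E (suc y) * (k * k ^ y)   ≡⟨ eq₁ (E (suc y)) k (k ^ y) ⟩
  k * E (suc y) * k ^ y     ≤⟨ *-monoˡ-≤ (k ^ y) (scaledExp-decay k n y) ⟩
  suc k * E y * k ^ y       ≡⟨ *-assoc (suc k) (E y) (k ^ y) ⟩
  suc k * (E y * k ^ y)     ≤⟨ *-monoʳ-≤ (suc k) (scaledExp-bound k n y) ⟩
  suc k * (suc k ^ y * E 0) ≡⟨ *-assoc (suc k) (suc k ^ y) (E 0) ⟨
  suc k ^ suc y * E 0       ∎
  where
  open ≤-Reasoning
  E = scaledExp (suc k) n
  eq₁ : ∀ a b c → a * (b * c) ≡ b * a * c
  eq₁ = solve-∀

scaledExp-zero : ∀ L n → scaledExp L n 0 ≡ L ^ n * n !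
scaledExp-zero L zero    = refl
scaledExp-zero L (suc n) = begin
  suc n * (L * scaledExp L n 0) + 0 ≡⟨ cong (λ s → suc n * (L * s) + 0) (scaledExp-zero L n) ⟩
  suc n * (L * (L ^ n * n !)) + 0   ≡⟨ eq (suc n) L (L ^ n) (n !) ⟩
  L * L ^ n * (suc n * n !)         ∎
  where
  open ≡-Reasoning
  eq : ∀ n L p f → n * (L * (p * f)) + 0 ≡ L * p * (n * f)
  eq = solve-∀

scaledExp-multiple : ∀ L n t → scaledExp L n (L * t) ≡ L ^ n * expNumer t n
scaledExp-multiple L zero    t = refl
scaledExp-multiple L (suc n) t = begin
  suc n * (L * scaledExp L n (L * t)) + (L * t) ^ suc n
    ≡⟨ cong₂ (λ s p → suc n * (L * s) + p) (scaledExp-multiple L n t) (^-distribʳ-* L t (suc n)) ⟩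
  suc n * (L * (L ^ n * expNumer t n)) + L * L ^ n * t ^ suc n
    ≡⟨ eq (suc n) L (L ^ n) (expNumer t n) (t ^ suc n) ⟩
  L * L ^ n * (suc n * expNumer t n + t ^ suc n) ∎
  where
  open ≡-Reasoning
  eq : ∀ n L p e r → n * (L * (p * e)) + L * p * r ≡ L * p * (n * e + r)
  eq = solve-∀

-- e ≤ (1 + 1/k)^{k+1}
ExpLe-intro : ∀ k .{{_ : NonZero k}} t Y →
              suc k ^ (suc k * t) ≤ Y * k ^ (suc k * t) → ExpLe t Y
ExpLe-intro k t Y bound n =
  *-cancelˡ-≤ (L ^ n * k ^ e) {{m*n≢0 _ _ {{m^n≢0 L n}} {{m^n≢0 k e}}}} (begin
  L ^ n * k ^ e * expNumer t n     ≡⟨ eq₁ (L ^ n) (k ^ e) (expNumer t n) ⟩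
  L ^ n * expNumer t n * k ^ e     ≡⟨ cong (_* k ^ e) (scaledExp-multiple L n t) ⟨
  scaledExp L n e * k ^ e          ≤⟨ scaledExp-bound k n e ⟩
  L ^ e * scaledExp L n 0          ≡⟨ cong (L ^ e *_) (scaledExp-zero L n) ⟩
  L ^ e * (L ^ n * n !)            ≤⟨ *-monoˡ-≤ (L ^ n * n !) bound ⟩
  Y * k ^ e * (L ^ n * n !)        ≡⟨ eq₂ Y (k ^ e) (L ^ n) (n !) ⟩
  L ^ n * k ^ e * (Y * n !)        ∎)
  where
  open ≤-Reasoning
  L = suc k
  e = L * t
  eq₁ : ∀ a b c → a * b * c ≡ a * c * b
  eq₁ = solve-∀
  eq₂ : ∀ a b c d → a * b * (c * d) ≡ c * b * (a * d)
  eq₂ = solve-∀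

-- Sums and counting in a projective plane

sumFin-cong : ∀ n {f g : Fin n → ℕ} → (∀ i → f i ≡ g i) → sumFin n f ≡ sumFin n g
sumFin-cong zero    f≡g = refl
sumFin-cong (suc n) f≡g = cong₂ _+_ (f≡g zero) (sumFin-cong n (f≡g ∘ suc))

sumFin-mono-≤ : ∀ n {f g : Fin n → ℕ} → (∀ i → f i ≤ g i) → sumFin n f ≤ sumFin n g
sumFin-mono-≤ zero    f≤g = z≤n
sumFin-mono-≤ (suc n) f≤g = +-mono-≤ (f≤g zero) (sumFin-mono-≤ n (f≤g ∘ suc))

sumFin-mono-< : ∀ n {f g : Fin n → ℕ} → (∀ i → f i ≤ g i) →
                ∀ i → f i < g i → sumFin n f < sumFin n g
sumFin-mono-< (suc n) f≤g zero    f<g = +-mono-<-≤ f<g (sumFin-mono-≤ n (f≤g ∘ suc))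
sumFin-mono-< (suc n) f≤g (suc i) f<g = +-mono-≤-< (f≤g zero) (sumFin-mono-< n (f≤g ∘ suc) i f<g)

sumFin-+ : ∀ n (f g : Fin n → ℕ) → sumFin n (λ i → f i + g i) ≡ sumFin n f + sumFin n g
sumFin-+ zero    f g = refl
sumFin-+ (suc n) f g =
  trans (cong (f zero + g zero +_) (sumFin-+ n (f ∘ suc) (g ∘ suc)))
        (interchange (f zero) (g zero) _ _)
  where
  interchange : ∀ a b c d → a + b + (c + d) ≡ a + c + (b + d)
  interchange = solve-∀

sumFin-*ˡ : ∀ n c (f : Fin n → ℕ) → sumFin n (λ i → c * f i) ≡ c * sumFin n f
sumFin-*ˡ zero    c f = sym (*-zeroʳ c)
sumFin-*ˡ (suc n) c f =
  trans (cong (c * f zero +_) (sumFin-*ˡ n c (f ∘ suc))) (sym (*-distribˡ-+ c (f zero) _))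

sumFin-const : ∀ n c → sumFin n (λ _ → c) ≡ n * c
sumFin-const zero    c = refl
sumFin-const (suc n) c = cong (c +_) (sumFin-const n c)

sumFin-swap : ∀ m n (f : Fin m → Fin n → ℕ) →
  sumFin m (λ i → sumFin n (f i)) ≡ sumFin n (λ j → sumFin m (λ i → f i j))
sumFin-swap zero    n f = sym (trans (sumFin-const n 0) (*-zeroʳ n))
sumFin-swap (suc m) n f =
  trans (cong (sumFin n (f zero) +_) (sumFin-swap m n (f ∘ suc)))
        (sym (sumFin-+ n (f zero) (λ j → sumFin m (λ i → f (suc i) j))))

sumFin-single : ∀ n (f : Fin n → ℕ) i → (∀ j → j ≢ i → f j ≡ 0) → sumFin n f ≡ f i
sumFin-single (suc n) f zero    f≡0 =
  trans (cong (f zero +_) (trans (sumFin-cong n (λ j → f≡0 (suc j) λ ()))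
                                 (trans (sumFin-const n 0) (*-zeroʳ n))))
        (+-identityʳ _)
sumFin-single (suc n) f (suc i) f≡0 =
  cong₂ _+_ (f≡0 zero λ ())
            (sumFin-single n (f ∘ suc) i (λ j j≢i → f≡0 (suc j) (j≢i ∘ Fin.suc-injective)))

sumFin-zero : ∀ n (f : Fin n → ℕ) → sumFin n f ≡ 0 → ∀ i → f i ≡ 0
sumFin-zero (suc n) f Σ≡0 zero    = m+n≡0⇒m≡0 (f zero) Σ≡0
sumFin-zero (suc n) f Σ≡0 (suc i) = sumFin-zero n (λ j → f (suc j)) (m+n≡0⇒n≡0 (f zero) Σ≡0) i

sumFin-positive : ∀ n (f : Fin n → ℕ) → 1 ≤ sumFin n f → ∃ λ i → 1 ≤ f i
sumFin-positive (suc n) f 1≤Σ with f zero in eq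
... | suc _ = zero , subst (1 ≤_) (sym eq) (s≤s z≤n)
... | zero  with i , 1≤fi ← sumFin-positive n (f ∘ suc) 1≤Σ = suc i , 1≤fi

sumFin-average : ∀ n (f : Fin n → ℕ) → 1 ≤ n → ∃ λ i → n * f i ≤ sumFin n f
sumFin-average (suc zero)      f _ = zero , ≤-refl
sumFin-average (suc n@(suc _)) f _ with i , nfi≤Σ ← sumFin-average n (f ∘ suc) (s≤s z≤n)
                                   with ≤-total (f zero) (f (suc i))
... | inj₁ f0≤fi = zero , +-monoʳ-≤ (f zero) (≤-trans (*-monoʳ-≤ n f0≤fi) nfi≤Σ)
... | inj₂ fi≤f0 = suc i , +-mono-≤ fi≤f0 nfi≤Σ

⟦_⟧ : Bool → ℕ
⟦ b ⟧ = if b then 1 else 0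

∣∣-sumFin : ∀ {n} (S : Subset n) → ∣ S ∣ ≡ sumFin n (λ P → ⟦ lookup S P ⟧)
∣∣-sumFin []          = refl
∣∣-sumFin (true  ∷ S) = cong suc (∣∣-sumFin S)
∣∣-sumFin (false ∷ S) = ∣∣-sumFin S

⟦∧⟧ : ∀ b c → ⟦ b ∧ c ⟧ ≡ ⟦ b ⟧ * ⟦ c ⟧
⟦∧⟧ true  c = sym (+-identityʳ ⟦ c ⟧)
⟦∧⟧ false c = refl

true≢false : true ≢ false
true≢false ()

-- Incidence counts in a plane of order q

module Plane {q} (Π : ProjectivePlane q) where

  inc : Fin (nP Π) → Fin (nL Π) → ℕ
  inc P ℓ = ⟦ I Π P ℓ ⟧

  ∑P : (Fin (nP Π) → ℕ) → ℕ
  ∑P = sumFin (nP Π)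

  ∑L : (Fin (nL Π) → ℕ) → ℕ
  ∑L = sumFin (nL Π)

  degree : Fin (nP Π) → ℕ
  degree P = ∑L (inc P)

  size : Fin (nL Π) → ℕ
  size ℓ = ∑P (λ P → inc P ℓ)

  ∣∩pointsOn∣ : ∀ S ℓ → ∣ S ∩ pointsOn Π ℓ ∣ ≡ ∑P (λ P → ⟦ lookup S P ⟧ * inc P ℓ)
  ∣∩pointsOn∣ S ℓ = trans (∣∣-sumFin (S ∩ pointsOn Π ℓ)) (sumFin-cong (nP Π) λ P →
    trans (cong ⟦_⟧ (trans (lookup-zipWith _∧_ P S (pointsOn Π ℓ))
                           (cong (lookup S P ∧_) (lookup∘tabulate (λ R → I Π R ℓ) P))))
          (⟦∧⟧ (lookup S P) (I Π P ℓ)))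

  ∣pointsOn∣ : ∀ ℓ → ∣ pointsOn Π ℓ ∣ ≡ size ℓ
  ∣pointsOn∣ ℓ = trans (∣∣-sumFin (pointsOn Π ℓ)) (sumFin-cong (nP Π) λ P →
    cong ⟦_⟧ (lookup∘tabulate (λ R → I Π R ℓ) P))

  ∑-joins : ∀ P Q → P ≢ Q → ∑L (λ ℓ → inc P ℓ * inc Q ℓ) ≡ 1
  ∑-joins P Q P≢Q with ℓ , P∈ℓ , Q∈ℓ , unique ← joinUnique Π P Q P≢Q =
    trans (sumFin-single (nL Π) _ ℓ others) (cong₂ (λ b c → ⟦ b ⟧ * ⟦ c ⟧) P∈ℓ Q∈ℓ)
    where
    others : ∀ m → m ≢ ℓ → inc P m * inc Q m ≡ 0
    others m m≢ℓ with I Π P m in P∈m | I Π Q m in Q∈m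
    ... | true  | true  = ⊥-elim (m≢ℓ (unique m P∈m Q∈m))
    ... | true  | false = refl
    ... | false | _     = refl

  ∑-meets : ∀ ℓ m → ℓ ≢ m → ∑P (λ P → inc P ℓ * inc P m) ≡ 1
  ∑-meets ℓ m ℓ≢m with P , P∈ℓ , P∈m , unique ← meetUnique Π ℓ m ℓ≢m =
    trans (sumFin-single (nP Π) _ P others) (cong₂ (λ b c → ⟦ b ⟧ * ⟦ c ⟧) P∈ℓ P∈m)
    where
    others : ∀ R → R ≢ P → inc R ℓ * inc R m ≡ 0
    others R R≢P with I Π R ℓ in R∈ℓ | I Π R m in R∈m
    ... | true  | true  = ⊥-elim (R≢P (unique R R∈ℓ R∈m))
    ... | true  | false = refl
    ... | false | _     = refl

  ⟦⟧*-cong : ∀ b {x y} → (b ≡ true → x ≡ y) → ⟦ b ⟧ * x ≡ ⟦ b ⟧ * y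
  ⟦⟧*-cong true  x≡y = cong (1 *_) (x≡y refl)
  ⟦⟧*-cong false x≡y = refl

  -- Both sides count the flags (P , m) with P on ℓ and m through Q.
  degree≡size : ∀ Q ℓ → I Π Q ℓ ≡ false → degree Q ≡ size ℓ
  degree≡size Q ℓ Q∉ℓ = begin
    ∑L (λ m → inc Q m)
      ≡⟨ sumFin-cong (nL Π) (λ m → trans (sym (*-identityʳ (inc Q m)))
           (⟦⟧*-cong (I Π Q m) λ Q∈m → sym (∑-meets m ℓ λ { refl → true≢false (trans (sym Q∈m) Q∉ℓ) }))) ⟩
    ∑L (λ m → inc Q m * ∑P (λ P → inc P m * inc P ℓ))
      ≡⟨ sumFin-cong (nL Π) (λ m → sumFin-*ˡ (nP Π) (inc Q m) _) ⟨
    ∑L (λ m → ∑P (λ P → inc Q m * (inc P m * inc P ℓ)))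
      ≡⟨ sumFin-swap (nL Π) (nP Π) _ ⟩
    ∑P (λ P → ∑L (λ m → inc Q m * (inc P m * inc P ℓ)))
      ≡⟨ sumFin-cong (nP Π) (λ P → sumFin-cong (nL Π) (λ m → rotate (inc Q m) (inc P m) (inc P ℓ))) ⟩
    ∑P (λ P → ∑L (λ m → inc P ℓ * (inc P m * inc Q m)))
      ≡⟨ sumFin-cong (nP Π) (λ P → sumFin-*ˡ (nL Π) (inc P ℓ) _) ⟩
    ∑P (λ P → inc P ℓ * ∑L (λ m → inc P m * inc Q m))
      ≡⟨ sumFin-cong (nP Π) (λ P → trans (⟦⟧*-cong (I Π P ℓ) λ P∈ℓ →
           ∑-joins P Q λ { refl → true≢false (trans (sym P∈ℓ) Q∉ℓ) }) (*-identityʳ (inc P ℓ))) ⟩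
    ∑P (λ P → inc P ℓ) ∎
    where
    open ≡-Reasoning
    rotate : ∀ a b c → a * (b * c) ≡ c * (b * a)
    rotate = solve-∀

  line-unique : ∀ {P Q ℓ m} → P ≢ Q → I Π P ℓ ≡ true → I Π Q ℓ ≡ true →
                I Π P m ≡ true → I Π Q m ≡ true → ℓ ≡ m
  line-unique P≢Q P∈ℓ Q∈ℓ P∈m Q∈m with _ , _ , _ , unique ← joinUnique Π _ _ P≢Q =
    trans (unique _ P∈ℓ Q∈ℓ) (sym (unique _ P∈m Q∈m))

  private
    NonCollinear : (P Q R : Fin (nP Π)) → Set
    NonCollinear P Q R = Collinear Π P Q R → ⊥

    swap₁₂ : ∀ {P Q R} → NonCollinear P Q R → NonCollinear Q P R
    swap₁₂ PQR (ℓ , Q∈ , P∈ , R∈) = PQR (ℓ , P∈ , Q∈ , R∈)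

    swap₂₃ : ∀ {P Q R} → NonCollinear P Q R → NonCollinear P R Q
    swap₂₃ PQR (ℓ , P∈ , R∈ , Q∈) = PQR (ℓ , P∈ , Q∈ , R∈)

  size-order : size (proj₁ (order Π)) ≡ suc q
  size-order = trans (sym (∣pointsOn∣ _)) (proj₂ (order Π))

  -- The quadrangle axiom states only non-collinearity, and to conclude from it that two of its
  -- points differ one already needs a line through them. Allowing P = Q avoids this circle: the
  -- line of `order` has a point R, and either P = R or the line PR passes through P.
  join : ∀ P Q → ∃ λ ℓ → I Π P ℓ ≡ true × I Π Q ℓ ≡ true
  join P Q with P Fin.≟ Q
  ... | no P≢Q with ℓ , P∈ℓ , Q∈ℓ , _ ← joinUnique Π P Q P≢Q = ℓ , P∈ℓ , Q∈ℓ
  ... | yes refl with R , 1≤ ← sumFin-positive (nP Π) _ (subst (1 ≤_) (sym size-order) (s≤s z≤n))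
                 with I Π R (proj₁ (order Π)) in R∈ℓ | P Fin.≟ R
  ...   | true | yes refl = proj₁ (order Π) , R∈ℓ , R∈ℓ
  ...   | true | no P≢R with ℓ , P∈ℓ , _ ← joinUnique Π P R P≢R = ℓ , P∈ℓ , P∈ℓ

  -- The point is the intersection of the lines AC′ and BD.
  diagonal-point : ∀ {A B C′ D ℓ m} → NonCollinear A B C′ → NonCollinear A B D →
    NonCollinear A C′ D → NonCollinear B C′ D →
    I Π A ℓ ≡ true → I Π B ℓ ≡ true → I Π C′ m ≡ true → I Π D m ≡ true →
    ∃ λ O → I Π O ℓ ≡ false × I Π O m ≡ false
  diagonal-point {A} {B} {C′} {D} {ℓ} {m} ABC ABD ACD BCD A∈ℓ B∈ℓ C∈m D∈m
    with n , A∈n , C∈n ← join A C′ | p , B∈p , D∈p ← join B D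
    with X , X∈n , X∈p , _ ← meetUnique Π n p (λ { refl → ABC (n , A∈n , B∈p , C∈n) })
    = X , ¬-not X∉ℓ , ¬-not X∉m
    where
    X∉ℓ : I Π X ℓ ≢ true
    X∉ℓ X∈ℓ with X Fin.≟ A
    ... | yes refl = ABD (p , X∈p , B∈p , D∈p)
    ... | no X≢A with refl ← line-unique X≢A X∈ℓ A∈ℓ X∈n A∈n = ABC (n , A∈n , B∈ℓ , C∈n)
    X∉m : I Π X m ≢ true
    X∉m X∈m with X Fin.≟ C′
    ... | yes refl = BCD (p , B∈p , X∈p , D∈p)
    ... | no X≢C with refl ← line-unique X≢C X∈m C∈m X∈n C∈n = ACD (n , A∈n , C∈n , D∈m)

  -- If the two lines cover the quadrangle, then no three of its points being collinear puts exactly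
  -- two on each line, and a diagonal point of the quadrangle avoids both. Through such a point
  -- `degree≡size` transfers the size of one line to any other.
  point-off-lines : ∀ ℓ m → ∃ λ O → I Π O ℓ ≡ false × I Π O m ≡ false
  point-off-lines ℓ m with A , B , C′ , D , ABC , ABD , ACD , BCD ← quadrangle Π =
    go (classify A) (classify B) (classify C′) (classify D)
    where
    Off = ∃ λ O → I Π O ℓ ≡ false × I Π O m ≡ false
    flip : (∃ λ O → I Π O m ≡ false × I Π O ℓ ≡ false) → Off
    flip (O , O∉m , O∉ℓ) = O , O∉ℓ , O∉m
    data Position (P : Fin (nP Π)) : Set where
      off : Off → Position P
      onℓ : I Π P ℓ ≡ true → Position P
      onm : I Π P m ≡ true → Position P
    classify : ∀ P → Position P
    classify P with I Π P ℓ in P∈ℓ | I Π P m in P∈m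
    ... | true  | _     = onℓ P∈ℓ
    ... | false | true  = onm P∈m
    ... | false | false = off (P , P∈ℓ , P∈m)
    go : Position A → Position B → Position C′ → Position D → Off
    go (off O) _ _ _ = O
    go _ (off O) _ _ = O
    go _ _ (off O) _ = O
    go _ _ _ (off O) = O
    go (onℓ a) (onℓ b) (onℓ c) _       = ⊥-elim (ABC (ℓ , a , b , c))
    go (onℓ a) (onℓ b) _       (onℓ d) = ⊥-elim (ABD (ℓ , a , b , d))
    go (onℓ a) _       (onℓ c) (onℓ d) = ⊥-elim (ACD (ℓ , a , c , d))
    go _       (onℓ b) (onℓ c) (onℓ d) = ⊥-elim (BCD (ℓ , b , c , d))
    go (onm a) (onm b) (onm c) _       = ⊥-elim (ABC (m , a , b , c))
    go (onm a) (onm b) _       (onm d) = ⊥-elim (ABD (m , a , b , d))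
    go (onm a) _       (onm c) (onm d) = ⊥-elim (ACD (m , a , c , d))
    go _       (onm b) (onm c) (onm d) = ⊥-elim (BCD (m , b , c , d))
    go (onℓ a) (onℓ b) (onm c) (onm d) = diagonal-point ABC ABD ACD BCD a b c d
    go (onm a) (onm b) (onℓ c) (onℓ d) = flip (diagonal-point ABC ABD ACD BCD a b c d)
    go (onℓ a) (onm b) (onℓ c) (onm d) =
      diagonal-point (swap₂₃ ABC) ACD ABD (swap₁₂ BCD) a c b d
    go (onm a) (onℓ b) (onm c) (onℓ d) =
      flip (diagonal-point (swap₂₃ ABC) ACD ABD (swap₁₂ BCD) a c b d)
    go (onℓ a) (onm b) (onm c) (onℓ d) =
      diagonal-point (swap₂₃ ABD) (swap₂₃ ACD) ABC (swap₁₂ (swap₂₃ BCD)) a d b c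
    go (onm a) (onℓ b) (onℓ c) (onm d) =
      flip (diagonal-point (swap₂₃ ABD) (swap₂₃ ACD) ABC (swap₁₂ (swap₂₃ BCD)) a d b c)

  line-off-point : ∀ P → ∃ λ ℓ → I Π P ℓ ≡ false
  line-off-point P with A , B , C′ , _ , ABC , _ ← quadrangle Π
                   with ℓ , A∈ℓ , B∈ℓ ← join A B | m , A∈m , C∈m ← join A C′ | n , B∈n , C∈n ← join B C′
                   with I Π P ℓ in P∈ℓ | I Π P m in P∈m | I Π P n in P∈n
  ... | false | _     | _     = ℓ , P∈ℓ
  ... | _     | false | _     = m , P∈m
  ... | _     | _     | false = n , P∈n
  ... | true  | true  | true with P Fin.≟ A
  ...   | yes refl = ⊥-elim (ABC (n , P∈n , B∈n , C∈n))
  ...   | no P≢A with refl ← line-unique P≢A P∈ℓ A∈ℓ P∈m A∈m = ⊥-elim (ABC (ℓ , A∈ℓ , B∈ℓ , C∈m))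

  size≡ : ∀ ℓ → size ℓ ≡ suc q
  size≡ ℓ with O , O∉ℓ , O∉ℓ₀ ← point-off-lines ℓ (proj₁ (order Π)) =
    trans (sym (degree≡size O ℓ O∉ℓ)) (trans (degree≡size O _ O∉ℓ₀) size-order)

  degree≡ : ∀ P → degree P ≡ suc q
  degree≡ P with ℓ , P∉ℓ ← line-off-point P = trans (degree≡size P ℓ P∉ℓ) (size≡ ℓ)

  δ : Fin (nP Π) → Fin (nP Π) → ℕ
  δ P Q with P Fin.≟ Q
  ... | yes _ = 1
  ... | no  _ = 0

  δ-refl : ∀ P → δ P P ≡ 1
  δ-refl P with P Fin.≟ P
  ... | yes _   = refl
  ... | no  P≢P = ⊥-elim (P≢P refl)

  ∑-δ : ∀ Q (f : Fin (nP Π) → ℕ) → ∑P (λ P → δ P Q * f P) ≡ f Q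
  ∑-δ Q f = trans (sumFin-single (nP Π) _ Q others) (trans (cong (_* f Q) (δ-refl Q)) (+-identityʳ (f Q)))
    where
    others : ∀ P → P ≢ Q → δ P Q * f P ≡ 0
    others P P≢Q with P Fin.≟ Q
    ... | yes P≡Q = ⊥-elim (P≢Q P≡Q)
    ... | no  _   = refl

  ∑-lines-through : ∀ Q (f : Fin (nL Π) → ℕ) →
    ∑P (λ P → ∑L (λ ℓ → inc P ℓ * (inc Q ℓ * f ℓ))) ≡ suc q * ∑L (λ ℓ → inc Q ℓ * f ℓ)
  ∑-lines-through Q f = begin
    ∑P (λ P → ∑L (λ ℓ → inc P ℓ * (inc Q ℓ * f ℓ)))
      ≡⟨ sumFin-swap (nP Π) (nL Π) _ ⟩
    ∑L (λ ℓ → ∑P (λ P → inc P ℓ * (inc Q ℓ * f ℓ)))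
      ≡⟨ sumFin-cong (nL Π) (λ ℓ → trans (sumFin-cong (nP Π) λ P → *-comm (inc P ℓ) _)
           (trans (sumFin-*ˡ (nP Π) (inc Q ℓ * f ℓ) _) (trans (*-comm (inc Q ℓ * f ℓ) (size ℓ)) (cong (_* (inc Q ℓ * f ℓ)) (size≡ ℓ))))) ⟩
    ∑L (λ ℓ → suc q * (inc Q ℓ * f ℓ))
      ≡⟨ sumFin-*ˡ (nL Π) (suc q) _ ⟩
    suc q * ∑L (λ ℓ → inc Q ℓ * f ℓ) ∎
    where open ≡-Reasoning

  -- Counts the pairs of a point P and a line through P and a fixed point Q. Every P other than Q
  -- lies in one pair and Q itself in q + 1; the `δ` terms correct for Q without subtraction.
  nP≡ : nP Π ≡ q * q + q + 1
  nP≡ = +-cancelʳ-≡ (suc q) _ _ (begin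
    nP Π + suc q
      ≡⟨ cong₂ _+_ (trans (sumFin-const (nP Π) 1) (*-identityʳ (nP Π)))
                   (trans (∑-δ Q (λ _ → suc q)) refl) ⟨
    ∑P (λ _ → 1) + ∑P (λ P → δ P Q * suc q)
      ≡⟨ sumFin-+ (nP Π) _ _ ⟨
    ∑P (λ P → 1 + δ P Q * suc q)
      ≡⟨ sumFin-cong (nP Π) lines ⟩
    ∑P (λ P → ∑L (λ ℓ → inc P ℓ * (inc Q ℓ * 1)) + δ P Q * 1)
      ≡⟨ sumFin-+ (nP Π) _ _ ⟩
    ∑P (λ P → ∑L (λ ℓ → inc P ℓ * (inc Q ℓ * 1))) + ∑P (λ P → δ P Q * 1)
      ≡⟨ cong₂ _+_ (∑-lines-through Q (λ _ → 1)) (∑-δ Q (λ _ → 1)) ⟩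
    suc q * ∑L (λ ℓ → inc Q ℓ * 1) + 1
      ≡⟨ cong (λ d → suc q * d + 1)
           (trans (sumFin-cong (nL Π) λ ℓ → *-identityʳ (inc Q ℓ)) (degree≡ Q)) ⟩
    suc q * suc q + 1
      ≡⟨ eq q ⟩
    q * q + q + 1 + suc q ∎)
    where
    open ≡-Reasoning
    Q = proj₁ (quadrangle Π)
    eq : ∀ q → suc q * suc q + 1 ≡ q * q + q + 1 + suc q
    eq = solve-∀
    idem : ∀ b → ⟦ b ⟧ * (⟦ b ⟧ * 1) ≡ ⟦ b ⟧
    idem true  = refl
    idem false = refl
    lines : ∀ P → 1 + δ P Q * suc q ≡ ∑L (λ ℓ → inc P ℓ * (inc Q ℓ * 1)) + δ P Q * 1
    lines P with P Fin.≟ Q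
    ... | yes refl = trans (cong suc (+-identityʳ (suc q))) (trans (sym (+-comm (suc q) 1))
                       (cong (_+ 1) (sym (trans (sumFin-cong (nL Π) λ ℓ → idem (I Π P ℓ)) (degree≡ P)))))
    ... | no  P≢Q  = sym (trans (+-identityʳ _) (trans
                       (sumFin-cong (nL Π) λ ℓ → cong (inc P ℓ *_) (*-identityʳ (inc Q ℓ))) (∑-joins P Q P≢Q)))

-- The greedy construction

[1+n]C2 : ∀ n → suc n C 2 ≡ n + n C 2
[1+n]C2 n = trans (sym (nCk+nC[k+1]≡[n+1]C[k+1] n 1)) (cong (_+ n C 2) (nC1≡n n))

C2-mono-≤ : ∀ {m n} → m ≤ n → m C 2 ≤ n C 2
C2-mono-≤ z≤n = z≤n
C2-mono-≤ (s≤s {m} {n} m≤n) =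
  subst₂ _≤_ (sym ([1+n]C2 m)) (sym ([1+n]C2 n)) (+-mono-≤ m≤n (C2-mono-≤ m≤n))

-- Since 0 C 2 = 1 C 2, a new point raises the multiplicity of a line only if the line already meets
-- S. This is why `hit` counts only such lines.
C2-mono-< : ∀ {m n} → 1 ≤ m → m < n → m C 2 < n C 2
C2-mono-< {m} 1≤m m<n =
  ≤-trans (+-monoˡ-≤ (m C 2) 1≤m) (≤-trans (≤-reflexive (sym ([1+n]C2 m))) (C2-mono-≤ m<n))

sgn : ℕ → ℕ
sgn zero    = 0
sgn (suc _) = 1

sgn≤1 : ∀ n → sgn n ≤ 1
sgn≤1 zero    = z≤n
sgn≤1 (suc _) = ≤-refl

n≤1⇒n≤sgn : ∀ {n} → n ≤ 1 → n ≤ sgn n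
n≤1⇒n≤sgn z≤n       = z≤n
n≤1⇒n≤sgn (s≤s z≤n) = ≤-refl

-- This is n - 1 ≤ n C 2 for positive n. Summed over the lines through Q it bounds the points of S
-- by the lines meeting S plus the multiplicity of Q.
n≤sgn+nC2 : ∀ n → n ≤ sgn n + n C 2
n≤sgn+nC2 zero    = z≤n
n≤sgn+nC2 (suc n) = s≤s (≤-trans (m≤m+n n (n C 2)) (≤-reflexive (sym ([1+n]C2 n))))

if-≤ : ∀ b {x y : ℕ} → x ≤ y → (if b then x else 0) ≤ (if b then y else 0)
if-≤ true  x≤y = x≤y
if-≤ false _   = z≤n

if-split : ∀ b n x → n ≤ sgn n + x → ⟦ b ⟧ * n ≤ ⟦ b ⟧ * sgn n + (if b then x else 0)
if-split true  n x n≤ = subst₂ _≤_ (sym (+-identityʳ n)) (cong (_+ x) (sym (+-identityʳ (sgn n)))) n≤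
if-split false n x _  = z≤n

⟦⟧*≤ : ∀ b n → ⟦ b ⟧ * n ≤ n
⟦⟧*≤ true  n = ≤-reflexive (+-identityʳ n)
⟦⟧*≤ false n = z≤n

∣add∣ : ∀ {n} (S : Subset n) P → lookup S P ≡ false → ∣ S [ P ]≔ true ∣ ≡ suc ∣ S ∣
∣add∣ (false ∷ S) zero    refl = refl
∣add∣ (true  ∷ S) (suc P) P∉S  = cong suc (∣add∣ S P P∉S)
∣add∣ (false ∷ S) (suc P) P∉S  = ∣add∣ S P P∉S

subset-of-size : ∀ n k → k ≤ n → ∃ λ (S : Subset n) → ∣ S ∣ ≡ k
subset-of-size zero    zero    _         = [] , refl
subset-of-size (suc n) zero    _         with S , eq ← subset-of-size n zero z≤n = false ∷ S , eq
subset-of-size (suc n) (suc k) (s≤s k≤n) with S , eq ← subset-of-size n k k≤n = true ∷ S , cong suc eq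

-- weight d μ x = (1 + d)^{μ-1-x} if x < μ, and 0 otherwise.
weight : ℕ → ℕ → ℕ → ℕ
weight d zero    x       = 0
weight d (suc m) zero    = suc d ^ m
weight d (suc m) (suc x) = weight d m x

weight-suc : ∀ d μ x → suc d * weight d μ (suc x) ≤ weight d μ x
weight-suc d zero          x       = ≤-reflexive (*-zeroʳ (suc d))
weight-suc d (suc zero)    zero    = subst (_≤ 1) (sym (*-zeroʳ (suc d))) z≤n
weight-suc d (suc (suc m)) zero    = ≤-refl
weight-suc d (suc m)       (suc x) = weight-suc d m x

weight-anti : ∀ d μ {x y} → x ≤ y → weight d μ y ≤ weight d μ x
weight-anti d zero    x≤y              = z≤n
weight-anti d (suc m) (z≤n {zero})     = ≤-refl
weight-anti d (suc m) (z≤n {suc y})    =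
  ≤-trans (weight-anti d m (z≤n {y})) (below m)
  where
  below : ∀ m → weight d m 0 ≤ suc d ^ m
  below zero    = z≤n
  below (suc m) = m≤m+n (suc d ^ m) (d * suc d ^ m)
weight-anti d (suc m) (s≤s x≤y)        = weight-anti d m x≤y

weight-zero : ∀ d μ x → weight d μ x ≡ 0 → μ ≤ x
weight-zero d zero    x       _  = z≤n
weight-zero d (suc m) zero    eq = ⊥-elim (≢-nonZero⁻¹ (suc d ^ m) {{m^n≢0 (suc d) m}} eq)
weight-zero d (suc m) (suc x) eq = s≤s (weight-zero d m x eq)

weight-large : ∀ d μ x → μ ≤ x → weight d μ x ≡ 0
weight-large d zero    x       _         = refl
weight-large d (suc m) (suc x) (s≤s m≤x) = weight-large d m x m≤x

-- As h ≥ κ(q-1) - m and (q-1)(q+3) exceeds q² + q + 1 by q - 4, it suffices that κ(q-4) ≥ m(q+3).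
-- In the worst case κ = 4, m = 3 this says q ≥ 25. Hence the denominator q + 3 and a start with 4 +
-- m points.
hits-vs-points : ∀ q m κ h → 25 ≤ q → m ≤ 3 → 4 ≤ κ → κ * q ≤ κ + m + h →
                 κ * (q * q + q + 1) ≤ h * (q + 3)
hits-vs-points q m κ h 25≤q m≤3 4≤κ κq≤
  with p , refl ← m≤n⇒∃[o]m+o≡n (≤-trans (≤ᵇ⇒≤ 4 25 _) 25≤q) =
  +-cancelʳ-≤ ((κ + m) * (q + 3)) _ _ (begin
    κ * (q * q + q + 1) + (κ + m) * (q + 3)
      ≤⟨ +-monoʳ-≤ (κ * (q * q + q + 1)) (*-monoˡ-≤ (q + 3) (+-monoʳ-≤ κ m≤3)) ⟩
    κ * (q * q + q + 1) + (κ + 3) * (q + 3)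
      ≡⟨ eq₁ κ p ⟩
    common κ p + (21 + 3 * p)
      ≤⟨ +-monoʳ-≤ (common κ p) (≤-trans (+-monoˡ-≤ (3 * p) (+-cancelˡ-≤ 4 _ _ 25≤q)) (*-monoˡ-≤ p 4≤κ)) ⟩
    common κ p + κ * p
      ≡⟨ eq₂ κ p ⟩
    κ * q * (q + 3)
      ≤⟨ *-monoˡ-≤ (q + 3) κq≤ ⟩
    (κ + m + h) * (q + 3)
      ≡⟨ trans (cong (_* (q + 3)) (+-comm (κ + m) h)) (*-distribʳ-+ (q + 3) h (κ + m)) ⟩
    h * (q + 3) + (κ + m) * (q + 3) ∎)
  where
  open ≤-Reasoning
  common : ℕ → ℕ → ℕ
  common κ p = κ * (p * p + 10 * p + 28)
  eq₁ : ∀ κ p → κ * ((4 + p) * (4 + p) + (4 + p) + 1) + (κ + 3) * ((4 + p) + 3)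
                ≡ κ * (p * p + 10 * p + 28) + (21 + 3 * p)
  eq₁ = solve-∀
  eq₂ : ∀ κ p → κ * (p * p + 10 * p + 28) + κ * p ≡ κ * (4 + p) * ((4 + p) + 3)
  eq₂ = solve-∀

add-member : ∀ {n} (S : Subset n) P → lookup S P ≡ true → S [ P ]≔ true ≡ S
add-member S P P∈S = trans (cong (S [ P ]≔_) (sym P∈S)) ([]≔-lookup S P)

average-drop : ∀ n .{{_ : NonZero n}} (f : Fin n → Fin n → ℕ) (g : Fin n → ℕ) a c →
  (∀ j → a * sumFin n (λ i → f i j) + c * n * g j ≤ a * n * g j) →
  ∃ λ i → a * sumFin n (f i) + c * sumFin n g ≤ a * sumFin n g
average-drop n f g a c drop
  with i , nf≤ ← sumFin-average n (λ i → sumFin n (f i)) (>-nonZero⁻¹ n) =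
  i , *-cancelˡ-≤ n (begin
  n * (a * sumFin n (f i) + c * sumFin n g)
    ≡⟨ eq₁ n a (sumFin n (f i)) c (sumFin n g) ⟩
  a * (n * sumFin n (f i)) + c * n * sumFin n g
    ≤⟨ +-monoˡ-≤ (c * n * sumFin n g) (*-monoʳ-≤ a nf≤) ⟩
  a * sumFin n (λ i → sumFin n (f i)) + c * n * sumFin n g
    ≡⟨ cong (λ s → a * s + c * n * sumFin n g) (sumFin-swap n n f) ⟩
  a * sumFin n (λ j → sumFin n (λ i → f i j)) + c * n * sumFin n g
    ≡⟨ cong₂ _+_ (sumFin-*ˡ n a _) (sumFin-*ˡ n (c * n) g) ⟨
  sumFin n (λ j → a * sumFin n (λ i → f i j)) + sumFin n (λ j → c * n * g j)
    ≡⟨ sumFin-+ n _ _ ⟨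
  sumFin n (λ j → a * sumFin n (λ i → f i j) + c * n * g j)
    ≤⟨ sumFin-mono-≤ n drop ⟩
  sumFin n (λ j → a * n * g j)
    ≡⟨ sumFin-*ˡ n (a * n) g ⟩
  a * n * sumFin n g
    ≡⟨ eq₂ a n (sumFin n g) ⟩
  n * (a * sumFin n g) ∎)
  where
  open ≤-Reasoning
  eq₁ : ∀ v a x b y → v * (a * x + b * y) ≡ a * (v * x) + b * v * y
  eq₁ = solve-∀
  eq₂ : ∀ a v x → a * v * x ≡ v * (a * x)
  eq₂ = solve-∀

-- Numerators, over the common denominator a, of the factors by which j greedy steps shrink the
-- potential. The step leaving a set of 4 + i + m points has κ = 4 + i.
factors : ℕ → ℕ → ℕ → List ℕ
factors a d zero    = []
factors a d (suc j) = (a ∸ d * (4 + j)) ∷ factors a d j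

descent : ∀ {v} (Φ : Subset v → ℕ) a d .{{_ : NonZero d}} m Φ₀ → 4 + m ≤ v → (∀ S → Φ S ≤ Φ₀) →
  (∀ S κ → 4 ≤ κ → ∣ S ∣ ≡ κ + m → ∃ λ P → a * Φ (S [ P ]≔ true) + d * κ * Φ S ≤ a * Φ S) →
  ∀ j → ∃ λ S → (Φ S ≡ 0 × ∣ S ∣ ≤ 4 + j + m) ⊎
                (∣ S ∣ ≡ 4 + j + m × Φ S * a ^ j ≤ Φ₀ * product (factors a d j))
descent {v} Φ a d m Φ₀ 4+m≤v Φ≤ step = go
  where
  open ≤-Reasoning
  eq₁ : ∀ a b c → a * (b * c) ≡ b * a * c
  eq₁ = solve-∀
  eq₂ : ∀ a b c → a * (b * c) ≡ b * (a * c)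
  eq₂ = solve-∀
  absorb : ∀ c x y → a * x + c * y ≤ a * y → a * x ≤ (a ∸ c) * y
  absorb c x y le = subst (a * x ≤_) (sym (*-distribʳ-∸ y a c)) (m+n≤o⇒m≤o∸n (a * x) {c * y} {a * y} le)
  go : ∀ j → ∃ λ S → (Φ S ≡ 0 × ∣ S ∣ ≤ 4 + j + m) ⊎
                     (∣ S ∣ ≡ 4 + j + m × Φ S * a ^ j ≤ Φ₀ * product (factors a d j))
  go zero with S , ∣S∣≡ ← subset-of-size v (4 + m) 4+m≤v = S , inj₂ (∣S∣≡ , *-monoˡ-≤ 1 (Φ≤ S))
  go (suc j) with go j
  ... | S , inj₁ (Φ≡0 , ∣S∣≤) = S , inj₁ (Φ≡0 , m≤n⇒m≤1+n ∣S∣≤)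
  ... | S , inj₂ (∣S∣≡ , ΦS≤) with P , drop ← step S (4 + j) (m≤m+n 4 j) ∣S∣≡
                              with lookup S P in P∈?S
  -- Averaging may select a point of S. The set is then unchanged, so the strictly positive drop
  -- `d * κ * Φ S` can only fit if the potential is already zero.
  ...   | true  = S , inj₁ (Φ≡0 , m≤n⇒m≤1+n (≤-reflexive ∣S∣≡))
    where
    c = d * (4 + j)
    Φ≡0 : Φ S ≡ 0
    Φ≡0 = *-cancelˡ-≡ (Φ S) 0 c {{m*n≢0 d (4 + j)}} (trans (n≤0⇒n≡0 (+-cancelˡ-≤ (a * Φ S) (c * Φ S) 0
      (subst₂ _≤_ (cong (λ T → a * Φ T + c * Φ S) (add-member S P P∈?S))
                  (sym (+-identityʳ (a * Φ S))) drop))) (sym (*-zeroʳ c)))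
  ...   | false = S [ P ]≔ true , inj₂ (trans (∣add∣ S P P∈?S) (cong suc ∣S∣≡) , (begin
      Φ (S [ P ]≔ true) * (a * a ^ j)
        ≡⟨ eq₁ (Φ (S [ P ]≔ true)) a (a ^ j) ⟩
      a * Φ (S [ P ]≔ true) * a ^ j
        ≤⟨ *-monoˡ-≤ (a ^ j) (absorb (d * (4 + j)) (Φ (S [ P ]≔ true)) (Φ S) drop) ⟩
      (a ∸ d * (4 + j)) * Φ S * a ^ j
        ≡⟨ *-assoc (a ∸ d * (4 + j)) (Φ S) (a ^ j) ⟩
      (a ∸ d * (4 + j)) * (Φ S * a ^ j)
        ≤⟨ *-monoʳ-≤ (a ∸ d * (4 + j)) ΦS≤ ⟩
      (a ∸ d * (4 + j)) * (Φ₀ * product (factors a d j))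
        ≡⟨ eq₂ (a ∸ d * (4 + j)) Φ₀ (product (factors a d j)) ⟩
      Φ₀ * product (factors a d (suc j)) ∎))

-- The potential of a point set in the plane

module Greedy {q} (Π : ProjectivePlane q) (d m : ℕ) where
  open Plane Π

  sec : Subset (nP Π) → Fin (nL Π) → ℕ
  sec S ℓ = ∣ S ∩ pointsOn Π ℓ ∣

  multiplicity : Subset (nP Π) → Fin (nP Π) → ℕ
  multiplicity S Q = ∑L (λ ℓ → if I Π Q ℓ then (sec S ℓ C 2) else 0)

  potentialAt : Subset (nP Π) → Fin (nP Π) → ℕ
  potentialAt S Q = if lookup S Q then 0 else weight d (suc m) (multiplicity S Q)

  potential : Subset (nP Π) → ℕ
  potential S = ∑P (potentialAt S)

  add : Subset (nP Π) → Fin (nP Π) → Subset (nP Π)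
  add S P = S [ P ]≔ true

  add-lookup : ∀ S P R → lookup S P ≡ false → ⟦ lookup S R ⟧ + δ R P ≡ ⟦ lookup (add S P) R ⟧
  add-lookup S P R P∉S with R Fin.≟ P
  ... | yes refl = trans (cong (λ b → ⟦ b ⟧ + 1) P∉S) (cong ⟦_⟧ (sym (lookup∘update P S true)))
  ... | no  R≢P  = trans (+-identityʳ _) (cong ⟦_⟧ (sym (lookup∘update′ R≢P S true)))

  sec-add : ∀ S P ℓ → lookup S P ≡ false → sec (add S P) ℓ ≡ sec S ℓ + inc P ℓ
  sec-add S P ℓ P∉S = begin
    sec (add S P) ℓ
      ≡⟨ ∣∩pointsOn∣ (add S P) ℓ ⟩
    ∑P (λ R → ⟦ lookup (add S P) R ⟧ * inc R ℓ)
      ≡⟨ sumFin-cong (nP Π) (λ R → trans (cong (_* inc R ℓ) (sym (add-lookup S P R P∉S)))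
           (*-distribʳ-+ (inc R ℓ) ⟦ lookup S R ⟧ (δ R P))) ⟩
    ∑P (λ R → ⟦ lookup S R ⟧ * inc R ℓ + δ R P * inc R ℓ)
      ≡⟨ sumFin-+ (nP Π) _ _ ⟩
    ∑P (λ R → ⟦ lookup S R ⟧ * inc R ℓ) + ∑P (λ R → δ R P * inc R ℓ)
      ≡⟨ cong₂ _+_ (sym (∣∩pointsOn∣ S ℓ)) (∑-δ P (λ R → inc R ℓ)) ⟩
    sec S ℓ + inc P ℓ ∎
    where open ≡-Reasoning

  multiplicity-term-mono : ∀ S P Q → lookup S P ≡ false → ∀ ℓ →
    (if I Π Q ℓ then (sec S ℓ C 2) else 0) ≤ (if I Π Q ℓ then (sec (add S P) ℓ C 2) else 0)
  multiplicity-term-mono S P Q P∉S ℓ =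
    if-≤ (I Π Q ℓ) (C2-mono-≤ (subst (sec S ℓ ≤_) (sym (sec-add S P ℓ P∉S)) (m≤m+n _ _)))

  multiplicity-mono : ∀ S P Q → multiplicity S Q ≤ multiplicity (add S P) Q
  multiplicity-mono S P Q with lookup S P in P∈?S
  ... | true  = ≤-reflexive (cong (λ T → multiplicity T Q) (sym (add-member S P P∈?S)))
  ... | false = sumFin-mono-≤ (nL Π) (multiplicity-term-mono S P Q P∈?S)

  multiplicity-hit : ∀ S P Q ℓ → lookup S P ≡ false → I Π P ℓ ≡ true → I Π Q ℓ ≡ true →
    1 ≤ sec S ℓ → multiplicity S Q < multiplicity (add S P) Q
  multiplicity-hit S P Q ℓ P∉S P∈ℓ Q∈ℓ 1≤sec =
    sumFin-mono-< (nL Π) (multiplicity-term-mono S P Q P∉S) ℓ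
      (subst (λ b → (if b then (sec S ℓ C 2) else 0) < (if b then (sec (add S P) ℓ C 2) else 0))
        (sym Q∈ℓ) (C2-mono-< 1≤sec (≤-reflexive (sym
          (trans (sec-add S P ℓ P∉S) (trans (cong (λ b → sec S ℓ + ⟦ b ⟧) P∈ℓ) (+-comm (sec S ℓ) 1)))))))

  secantsAt : Subset (nP Π) → Fin (nP Π) → Fin (nP Π) → ℕ
  secantsAt S Q P = ∑L (λ ℓ → inc P ℓ * (inc Q ℓ * sgn (sec S ℓ)))

  hit : Subset (nP Π) → Fin (nP Π) → Fin (nP Π) → ℕ
  hit S Q P = if lookup S P then 0 else sgn (secantsAt S Q P)

  linesMeeting : Subset (nP Π) → Fin (nP Π) → ℕ
  linesMeeting S Q = ∑L (λ ℓ → inc Q ℓ * sgn (sec S ℓ))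

  secantsAt≤ : ∀ S Q P → secantsAt S Q P ≤ ⟦ lookup S P ⟧ + hit S Q P + δ P Q * linesMeeting S Q
  secantsAt≤ S Q P with P Fin.≟ Q
  ... | yes _ = ≤-trans (sumFin-mono-≤ (nL Π) λ ℓ → ⟦⟧*≤ (I Π P ℓ) _)
                  (≤-trans (≤-reflexive (sym (+-identityʳ (linesMeeting S Q))))
                    (m≤n+m _ (⟦ lookup S P ⟧ + hit S Q P)))
  ... | no P≢Q = ≤-trans bound (m≤m+n _ 0)
    where
    ≤1 : secantsAt S Q P ≤ 1
    ≤1 = ≤-trans (sumFin-mono-≤ (nL Π) λ ℓ → *-monoʳ-≤ (inc P ℓ)
            (≤-trans (*-monoʳ-≤ (inc Q ℓ) (sgn≤1 (sec S ℓ))) (≤-reflexive (*-identityʳ (inc Q ℓ)))))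
          (≤-reflexive (∑-joins P Q P≢Q))
    bound : secantsAt S Q P ≤ ⟦ lookup S P ⟧ + hit S Q P
    bound with lookup S P
    ... | true  = ≤1
    ... | false = n≤1⇒n≤sgn ≤1

  ∣S∣≡∑sec : ∀ S Q → lookup S Q ≡ false → ∣ S ∣ ≡ ∑L (λ ℓ → inc Q ℓ * sec S ℓ)
  ∣S∣≡∑sec S Q Q∉S = sym (begin
    ∑L (λ ℓ → inc Q ℓ * sec S ℓ)
      ≡⟨ sumFin-cong (nL Π) (λ ℓ → trans (cong (inc Q ℓ *_) (∣∩pointsOn∣ S ℓ))
           (sym (sumFin-*ˡ (nP Π) (inc Q ℓ) _))) ⟩
    ∑L (λ ℓ → ∑P (λ P → inc Q ℓ * (⟦ lookup S P ⟧ * inc P ℓ)))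
      ≡⟨ sumFin-swap (nL Π) (nP Π) _ ⟩
    ∑P (λ P → ∑L (λ ℓ → inc Q ℓ * (⟦ lookup S P ⟧ * inc P ℓ)))
      ≡⟨ sumFin-cong (nP Π) (λ P → trans (sumFin-cong (nL Π) λ ℓ → rotate (inc Q ℓ) ⟦ lookup S P ⟧ (inc P ℓ))
           (sumFin-*ˡ (nL Π) ⟦ lookup S P ⟧ _)) ⟩
    ∑P (λ P → ⟦ lookup S P ⟧ * ∑L (λ ℓ → inc P ℓ * inc Q ℓ))
      ≡⟨ sumFin-cong (nP Π) (λ P → trans (⟦⟧*-cong (lookup S P) λ P∈S →
           ∑-joins P Q λ { refl → true≢false (trans (sym P∈S) Q∉S) }) (*-identityʳ _)) ⟩
    ∑P (λ P → ⟦ lookup S P ⟧)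
      ≡⟨ ∣∣-sumFin S ⟨
    ∣ S ∣ ∎)
    where
    open ≡-Reasoning
    rotate : ∀ a b c → a * (b * c) ≡ b * (c * a)
    rotate = solve-∀

  ∣S∣≤lines+multiplicity : ∀ S Q → lookup S Q ≡ false → ∣ S ∣ ≤ linesMeeting S Q + multiplicity S Q
  ∣S∣≤lines+multiplicity S Q Q∉S = begin
    ∣ S ∣
      ≡⟨ ∣S∣≡∑sec S Q Q∉S ⟩
    ∑L (λ ℓ → inc Q ℓ * sec S ℓ)
      ≤⟨ sumFin-mono-≤ (nL Π) (λ ℓ → if-split (I Π Q ℓ) (sec S ℓ) (sec S ℓ C 2) (n≤sgn+nC2 (sec S ℓ))) ⟩
    ∑L (λ ℓ → inc Q ℓ * sgn (sec S ℓ) + (if I Π Q ℓ then (sec S ℓ C 2) else 0))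
      ≡⟨ sumFin-+ (nL Π) _ _ ⟩
    linesMeeting S Q + multiplicity S Q ∎
    where open ≤-Reasoning

  -- Each line through Q that meets S has q points besides Q, and these points are distinct for
  -- distinct lines. Each of them lies in S or is a hit. The point Q itself is counted once per
  -- line, which is the summand r cancelled here.
  hits : ∀ S Q → q * linesMeeting S Q ≤ ∣ S ∣ + ∑P (hit S Q)
  hits S Q = +-cancelʳ-≤ r _ _ (begin
    q * r + r
      ≡⟨ +-comm (q * r) r ⟩
    suc q * r
      ≡⟨ ∑-lines-through Q (λ ℓ → sgn (sec S ℓ)) ⟨
    ∑P (secantsAt S Q)
      ≤⟨ sumFin-mono-≤ (nP Π) (secantsAt≤ S Q) ⟩
    ∑P (λ P → ⟦ lookup S P ⟧ + hit S Q P + δ P Q * r)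
      ≡⟨ trans (sumFin-+ (nP Π) _ _) (cong₂ _+_ (trans (sumFin-+ (nP Π) _ _)
           (cong (_+ ∑P (hit S Q)) (sym (∣∣-sumFin S)))) (∑-δ Q (λ _ → r))) ⟩
    ∣ S ∣ + ∑P (hit S Q) + r ∎)
    where
    open ≤-Reasoning
    r = linesMeeting S Q

  many-hits : ∀ S Q κ → ∣ S ∣ ≡ κ + m → lookup S Q ≡ false → multiplicity S Q ≤ m →
              κ * q ≤ κ + m + ∑P (hit S Q)
  many-hits S Q κ ∣S∣≡ Q∉S mult≤m = begin
    κ * q                        ≡⟨ *-comm κ q ⟩
    q * κ                        ≤⟨ *-monoʳ-≤ q κ≤r ⟩
    q * linesMeeting S Q         ≤⟨ hits S Q ⟩
    ∣ S ∣ + ∑P (hit S Q)         ≡⟨ cong (_+ ∑P (hit S Q)) ∣S∣≡ ⟩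
    κ + m + ∑P (hit S Q)         ∎
    where
    open ≤-Reasoning
    κ≤r : κ ≤ linesMeeting S Q
    κ≤r = +-cancelʳ-≤ m _ _ (subst (_≤ linesMeeting S Q + m) ∣S∣≡
            (≤-trans (∣S∣≤lines+multiplicity S Q Q∉S) (+-monoʳ-≤ _ mult≤m)))

  -- A hit divides the weight w by at least d + 1, so (d+1) w⁺ + d w ≤ w + d w. Without a hit it is
  -- enough that the weight does not grow.
  potentialAt-add : ∀ S Q P → suc d * potentialAt (add S P) Q + d * (hit S Q P * potentialAt S Q)
                              ≤ suc d * potentialAt S Q
  potentialAt-add S Q P with lookup S Q in Q∈?S
  ... | true  = ≤-reflexive (trans (cong₂ _+_ (trans (cong (suc d *_) zero′) (*-zeroʳ (suc d)))
                  (trans (cong (d *_) (*-zeroʳ (hit S Q P))) (*-zeroʳ d))) (sym (*-zeroʳ (suc d))))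
    where
    Q∈S⁺ : lookup (add S P) Q ≡ true
    Q∈S⁺ with Q Fin.≟ P
    ... | yes refl = lookup∘update Q S true
    ... | no  Q≢P  = trans (lookup∘update′ Q≢P S true) Q∈?S
    zero′ : potentialAt (add S P) Q ≡ 0
    zero′ = cong (λ b → if b then 0 else weight d (suc m) (multiplicity (add S P) Q)) Q∈S⁺
  ... | false = bound
    where
    w  = weight d (suc m) (multiplicity S Q)
    w⁺ = weight d (suc m) (multiplicity (add S P) Q)
    at≤ : potentialAt (add S P) Q ≤ w⁺
    at≤ with lookup (add S P) Q
    ... | true  = z≤n
    ... | false = ≤-refl
    w⁺≤w : w⁺ ≤ w
    w⁺≤w = weight-anti d (suc m) (multiplicity-mono S P Q)
    no-hit : suc d * potentialAt (add S P) Q + d * 0 ≤ suc d * w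
    no-hit = ≤-trans (≤-reflexive (trans (cong (suc d * potentialAt (add S P) Q +_) (*-zeroʳ d)) (+-identityʳ _)))
               (*-monoʳ-≤ (suc d) (≤-trans at≤ w⁺≤w))
    bound : suc d * potentialAt (add S P) Q + d * (hit S Q P * w) ≤ suc d * w
    bound with lookup S P in P∈?S
    ... | true  = no-hit
    ... | false with secantsAt S Q P in secants
    ...   | zero  = no-hit
    ...   | suc _ with ℓ , 1≤ ← sumFin-positive (nL Π) _ (subst (1 ≤_) (sym secants) (s≤s z≤n))
                  with I Π P ℓ in P∈ℓ | I Π Q ℓ in Q∈ℓ | sec S ℓ in sec≡
    ...     | true | true | suc _ = +-mono-≤
              (≤-trans (*-monoʳ-≤ (suc d) (≤-trans at≤ (weight-anti d (suc m)
                 (multiplicity-hit S P Q ℓ P∈?S P∈ℓ Q∈ℓ (subst (1 ≤_) (sym sec≡) (s≤s z≤n))))))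
                 (weight-suc d (suc m) (multiplicity S Q)))
              (*-monoʳ-≤ d (≤-reflexive (+-identityʳ w)))
    ...     | true | true | zero  with () ← 1≤

  potentialAt-sum : ∀ S Q → suc d * ∑P (λ P → potentialAt (add S P) Q) + d * (∑P (hit S Q) * potentialAt S Q)
                            ≤ suc d * (nP Π * potentialAt S Q)
  potentialAt-sum S Q = begin
    suc d * ∑P (λ P → potentialAt (add S P) Q) + d * (∑P (hit S Q) * w)
      ≡⟨ cong₂ _+_ (sym (sumFin-*ˡ (nP Π) (suc d) _))
           (trans (cong (d *_) (trans (*-comm _ w) (trans (sym (sumFin-*ˡ (nP Π) w _))
             (sumFin-cong (nP Π) λ P → *-comm w (hit S Q P))))) (sym (sumFin-*ˡ (nP Π) d _))) ⟩
    ∑P (λ P → suc d * potentialAt (add S P) Q) + ∑P (λ P → d * (hit S Q P * w))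
      ≡⟨ sumFin-+ (nP Π) _ _ ⟨
    ∑P (λ P → suc d * potentialAt (add S P) Q + d * (hit S Q P * w))
      ≤⟨ sumFin-mono-≤ (nP Π) (potentialAt-add S Q) ⟩
    ∑P (λ _ → suc d * w)
      ≡⟨ trans (sumFin-const (nP Π) _) (swap (nP Π) (suc d) w) ⟩
    suc d * (nP Π * w) ∎
    where
    open ≤-Reasoning
    w = potentialAt S Q
    swap : ∀ a b c → a * (b * c) ≡ b * (a * c)
    swap = solve-∀

  -- Chosen so that d κ / A = (1 - 1/(d+1)) κ / (q+3), the relative drop of the potential in one
  -- step.
  A : ℕ
  A = suc d * (q + 3)

  module _ (25≤q : 25 ≤ q) (m≤3 : m ≤ 3) where

    potentialAt-average : ∀ S Q κ → 4 ≤ κ → ∣ S ∣ ≡ κ + m →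
      A * ∑P (λ P → potentialAt (add S P) Q) + d * κ * nP Π * potentialAt S Q
      ≤ A * nP Π * potentialAt S Q
    potentialAt-average S Q κ 4≤κ ∣S∣≡ = begin
      suc d * (q + 3) * s + d * κ * nP Π * w
        ≡⟨ cong₂ _+_ (swap (suc d) (q + 3) s) (regroup d κ (nP Π) w) ⟩
      (q + 3) * (suc d * s) + d * (κ * nP Π * w)
        ≤⟨ +-monoʳ-≤ _ (*-monoʳ-≤ d hits≤) ⟩
      (q + 3) * (suc d * s) + d * (∑P (hit S Q) * (q + 3) * w)
        ≡⟨ factor (q + 3) (suc d * s) d (∑P (hit S Q)) w ⟩
      (q + 3) * (suc d * s + d * (∑P (hit S Q) * w))
        ≤⟨ *-monoʳ-≤ (q + 3) (potentialAt-sum S Q) ⟩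
      (q + 3) * (suc d * (nP Π * w))
        ≡⟨ rearrange (q + 3) (suc d) (nP Π) w ⟩
      suc d * (q + 3) * nP Π * w ∎
      where
      open ≤-Reasoning
      w = potentialAt S Q
      s = ∑P (λ P → potentialAt (add S P) Q)
      swap : ∀ a b c → a * b * c ≡ b * (a * c)
      swap = solve-∀
      regroup : ∀ a b c e → a * b * c * e ≡ a * (b * c * e)
      regroup = solve-∀
      factor : ∀ a b c e f → a * b + c * (e * a * f) ≡ a * (b + c * (e * f))
      factor = solve-∀
      rearrange : ∀ a b c e → a * (b * (c * e)) ≡ b * a * c * e
      rearrange = solve-∀
      hits≤ : κ * nP Π * w ≤ ∑P (hit S Q) * (q + 3) * w
      hits≤ with lookup S Q in Q∈?S
      ... | true  = ≤-reflexive (trans (*-zeroʳ (κ * nP Π)) (sym (*-zeroʳ (∑P (hit S Q) * (q + 3)))))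
      ... | false with suc m ≤? multiplicity S Q
      ...   | yes large = ≤-reflexive (trans (cong (κ * nP Π *_) w≡0) (trans (*-zeroʳ (κ * nP Π))
                (sym (trans (cong (∑P (hit S Q) * (q + 3) *_) w≡0) (*-zeroʳ (∑P (hit S Q) * (q + 3)))))))
        where w≡0 = weight-large d (suc m) (multiplicity S Q) large
      ...   | no small = *-monoˡ-≤ _ (subst (λ v → κ * v ≤ ∑P (hit S Q) * (q + 3)) (sym nP≡)
                (hits-vs-points q m κ _ 25≤q m≤3 4≤κ (many-hits S Q κ ∣S∣≡ Q∈?S (s≤s⁻¹ (≰⇒> small)))))

    greedy-step : ∀ S κ → 4 ≤ κ → ∣ S ∣ ≡ κ + m →
      ∃ λ P → A * potential (add S P) + d * κ * potential S ≤ A * potential S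
    greedy-step S κ 4≤κ ∣S∣≡ =
      average-drop (nP Π) {{subst NonZero (trans (+-comm 1 (q * q + q)) (sym nP≡)) _}}
        (λ P → potentialAt (add S P)) (potentialAt S) A (d * κ)
        (λ Q → potentialAt-average S Q κ 4≤κ ∣S∣≡)

    potential-initial : ∀ S → potential S ≤ suc d ^ m * nP Π
    potential-initial S =
      ≤-trans (sumFin-mono-≤ (nP Π) at≤)
              (≤-reflexive (trans (sumFin-const (nP Π) (suc d ^ m)) (*-comm (nP Π) (suc d ^ m))))
      where
      at≤ : ∀ Q → potentialAt S Q ≤ suc d ^ m
      at≤ Q with lookup S Q
      ... | true  = z≤n
      ... | false = weight-anti d (suc m) (z≤n {multiplicity S Q})

    greedy : .{{_ : NonZero d}} → ∀ j → ∃ λ S →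
      (potential S ≡ 0 × ∣ S ∣ ≤ 4 + j + m) ⊎
      (∣ S ∣ ≡ 4 + j + m × potential S * A ^ j ≤ suc d ^ m * nP Π * product (factors A d j))
    greedy = descent potential A d m (suc d ^ m * nP Π) 4+m≤nP potential-initial greedy-step
      where
      4+m≤nP : 4 + m ≤ nP Π
      4+m≤nP = ≤-trans (+-monoʳ-≤ 4 m≤3) (≤-trans (≤-trans (≤ᵇ⇒≤ 7 25 _) 25≤q)
        (subst (q ≤_) (sym nP≡) (≤-trans (m≤n+m q (q * q)) (m≤m+n (q * q + q) 1))))

  saturating : ∀ S → potential S ≡ 0 → Saturating Π (suc m) S
  saturating S Φ≡0 Q Q∉S = weight-zero d (suc m) _
    (trans (cong (λ b → if b then 0 else weight d (suc m) (multiplicity S Q)) (sym outside))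
           (sumFin-zero (nP Π) (potentialAt S) Φ≡0 Q))
    where
    outside : lookup S Q ≡ false
    outside with lookup S Q in Q∈?S
    ... | true  = ⊥-elim (Q∉S (lookup⇒[]= Q S Q∈?S))
    ... | false = refl

-- Size of the constructed set

length-factors : ∀ a d j → length (factors a d j) ≡ j
length-factors a d zero    = refl
length-factors a d (suc j) = cong suc (length-factors a d j)

sum-factors : ∀ a d j → d * (3 + j) ≤ a → 2 * sum (factors a d j) + d * (j * (j + 7)) ≡ 2 * a * j
sum-factors a d zero    _   = trans (*-zeroʳ d) (sym (*-zeroʳ (2 * a)))
sum-factors a d (suc j) d≤a = begin
  2 * (x + s) + d * (suc j * (suc j + 7))
    ≡⟨ eq₁ x s d j ⟩
  2 * s + d * (j * (j + 7)) + 2 * (x + d * (4 + j))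
    ≡⟨ cong₂ (λ u w → u + 2 * w) (sum-factors a d j (≤-trans (*-monoʳ-≤ d (n≤1+n (3 + j))) d≤a))
                                 (m∸n+n≡m d≤a) ⟩
  2 * a * j + 2 * a
    ≡⟨ eq₂ a j ⟩
  2 * a * suc j ∎
  where
  open ≡-Reasoning
  x = a ∸ d * (4 + j)
  s = sum (factors a d j)
  eq₁ : ∀ x s d j → 2 * (x + s) + d * (suc j * (suc j + 7))
                    ≡ 2 * s + d * (j * (j + 7)) + 2 * (x + d * (4 + j))
  eq₁ = solve-∀
  eq₂ : ∀ a j → 2 * a * j + 2 * a ≡ 2 * a * suc j
  eq₂ = solve-∀

product-factors : ∀ a d j → product (factors a d j) * 2 ^ j ≤ (2 * a ∸ d * (j + 7)) ^ j
product-factors a d zero = ≤-refl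
product-factors a d j@(suc i) with d * (4 + i) ≤? a
-- Here the truncated subtraction in the last factor gives 0, so the whole product vanishes.
-- Otherwise no factor is truncated and the exact sum is available for AM-GM.
... | no  d≰a rewrite m≤n⇒m∸n≡0 (<⇒≤ (≰⇒> d≰a)) = z≤n
... | yes d≤a = *-cancelʳ-≤ _ _ (j ^ j) {{n^n≢0 j}} (begin
  p * 2 ^ j * j ^ j       ≡⟨ eq p (2 ^ j) (j ^ j) ⟩
  p * j ^ j * 2 ^ j       ≤⟨ *-monoˡ-≤ (2 ^ j) (subst (λ l → p * l ^ l ≤ s ^ l) (length-factors a d j)
                               (am-gm (factors a d j))) ⟩
  s ^ j * 2 ^ j           ≡⟨ ^-distribʳ-* s 2 j ⟨
  (s * 2) ^ j             ≡⟨ cong (_^ j) (trans (*-comm s 2) 2s≡) ⟩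
  (x * j) ^ j             ≡⟨ ^-distribʳ-* x j j ⟩
  x ^ j * j ^ j           ∎)
  where
  open ≤-Reasoning
  p = product (factors a d j)
  s = sum (factors a d j)
  x = 2 * a ∸ d * (j + 7)
  eq : ∀ a b c → a * b * c ≡ a * c * b
  eq = solve-∀
  eq′ : ∀ d j → d * (j * (j + 7)) ≡ d * (j + 7) * j
  eq′ = solve-∀
  2s≡ : 2 * s ≡ x * j
  2s≡ = begin-equality
    2 * s                                            ≡⟨ m+n∸n≡m (2 * s) (d * (j * (j + 7))) ⟨
    2 * s + d * (j * (j + 7)) ∸ d * (j * (j + 7))    ≡⟨ cong₂ _∸_ (sum-factors a d j d≤a) (eq′ d j) ⟩
    2 * a * j ∸ d * (j + 7) * j                      ≡⟨ *-distribʳ-∸ j (2 * a) (d * (j + 7)) ⟨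
    x * j                                            ∎

-- Decay of powers against powers of 1 + 1/k

^-exchange : ∀ k G E → G ≤ E → suc k ^ G * k ^ E ≤ k ^ G * suc k ^ E
^-exchange k G E G≤E with f , refl ← m≤n⇒∃[o]m+o≡n G≤E = begin
  suc k ^ G * k ^ (G + f)         ≡⟨ cong (suc k ^ G *_) (^-distribˡ-+-* k G f) ⟩
  suc k ^ G * (k ^ G * k ^ f)     ≤⟨ *-monoʳ-≤ (suc k ^ G) (*-monoʳ-≤ (k ^ G) (^-monoˡ-≤ f (n≤1+n k))) ⟩
  suc k ^ G * (k ^ G * suc k ^ f) ≡⟨ eq (suc k ^ G) (k ^ G) (suc k ^ f) ⟩
  k ^ G * (suc k ^ G * suc k ^ f) ≡⟨ cong (k ^ G *_) (^-distribˡ-+-* (suc k) G f) ⟨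
  k ^ G * suc k ^ (G + f)         ∎
  where
  open ≤-Reasoning
  eq : ∀ a b c → a * (b * c) ≡ b * (a * c)
  eq = solve-∀

-- With y = z/(x+z) and v/(v+u) = 1 - y/2 - y²/8, this is the Taylor bound
-- 1 - y ≤ (1 - y/2 - y²/8)².
module SqrtBound (x z : ℕ) where
  u v : ℕ
  u = z * (4 * (x + z) + z)
  v = 8 * (x * x) + 12 * (x * z) + 3 * (z * z)

  v+u : v + u ≡ 8 * ((x + z) * (x + z))
  v+u = eq x z
    where
    eq : ∀ x z → 8 * (x * x) + 12 * (x * z) + 3 * (z * z) + z * (4 * (x + z) + z) ≡ 8 * ((x + z) * (x + z))
    eq = solve-∀

  sqrt-bound : x * ((v + u) * (v + u)) ≤ (x + z) * (v * v)
  sqrt-bound = subst (λ w → x * (w * w) ≤ (x + z) * (v * v)) (sym v+u)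
    (m+n≤o⇒m≤o _ (≤-reflexive (eq x z)))
    where
    eq : ∀ x z → x * (8 * ((x + z) * (x + z)) * (8 * ((x + z) * (x + z))))
                 + (x + z) * (8 * x * (z * z * z) + 9 * (z * z * (z * z)))
                 ≡ (x + z) * ((8 * (x * x) + 12 * (x * z) + 3 * (z * z)) * (8 * (x * x) + 12 * (x * z) + 3 * (z * z)))
    eq = solve-∀

  -- (1 - y)^H (1 + 1/k)^G ≤ 1 as soon as G ≤ k H (y + y²/4).
  decay : ∀ k .{{_ : NonZero k}} .{{_ : NonZero (x + z)}} G H → 4 * G * ((x + z) * (x + z)) ≤ k * u * H →
          suc k ^ G * x ^ H ≤ k ^ G * (x + z) ^ H
  -- The converse is raised to the power w: `sqrt-bound` trades (x/(x+z))^H for (v/w)^{2H}, and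
  -- `exp-lower` controls v/w only through its w-th power.
  decay k G H G≤ = ≮⇒≥ λ lt → <-irrefl refl (begin-strict
    k ^ (G * w) * L ^ E
      <⟨ *-cancelʳ-< (w ^ (2H * w)) _ _ (begin-strict
           k ^ (G * w) * L ^ E * w ^ (2H * w)
             ≡⟨ eq₁ (k ^ (G * w)) (L ^ E) (w ^ (2H * w)) ⟩
           k ^ (G * w) * w ^ (2H * w) * L ^ E
             <⟨ *-monoˡ-< (L ^ E) {{m^n≢0 L E}} (raised lt) ⟩
           L ^ (G * w) * v ^ (2H * w) * L ^ E
             ≡⟨ *-assoc (L ^ (G * w)) (v ^ (2H * w)) (L ^ E) ⟩
           L ^ (G * w) * (v ^ (2H * w) * L ^ E)
             ≤⟨ *-monoʳ-≤ (L ^ (G * w)) exp-power ⟩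
           L ^ (G * w) * (w ^ (2H * w) * k ^ E)
             ≡⟨ eq₂ (L ^ (G * w)) (w ^ (2H * w)) (k ^ E) ⟩
           L ^ (G * w) * k ^ E * w ^ (2H * w) ∎) ⟩
    L ^ (G * w) * k ^ E
      ≤⟨ ^-exchange k (G * w) E Gw≤E ⟩
    k ^ (G * w) * L ^ E ∎)
    where
    open ≤-Reasoning
    L = suc k
    w = v + u
    2H = H + H
    E = u * k * 2H
    instance
      w≢0 : NonZero w
      w≢0 = subst NonZero (sym v+u) (m*n≢0 8 _ {{_}} {{m*n≢0 (x + z) (x + z)}})
    eq₁ : ∀ a b c → a * b * c ≡ a * c * b
    eq₁ = solve-∀
    eq₂ : ∀ a b c → a * (b * c) ≡ a * c * b
    eq₂ = solve-∀
    Gw≤E : G * w ≤ E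
    Gw≤E = begin
      G * w                                 ≡⟨ cong (G *_) v+u ⟩
      G * (8 * ((x + z) * (x + z)))         ≡⟨ eq₃ G ((x + z) * (x + z)) ⟩
      2 * (4 * G * ((x + z) * (x + z)))     ≤⟨ *-monoʳ-≤ 2 G≤ ⟩
      2 * (k * u * H)                       ≡⟨ eq₄ k u H ⟩
      E                                     ∎
      where
      eq₃ : ∀ a b → a * (8 * b) ≡ 2 * (4 * a * b)
      eq₃ = solve-∀
      eq₄ : ∀ a b c → 2 * (a * b * c) ≡ b * a * (c + c)
      eq₄ = solve-∀
    exp-power : v ^ (2H * w) * L ^ E ≤ w ^ (2H * w) * k ^ E
    exp-power = subst₂ _≤_ (powers v L) (powers w k) (^-monoˡ-≤ 2H (exp-lower k v u))
      where
      powers : ∀ a b → (a ^ w * b ^ (u * k)) ^ 2H ≡ a ^ (2H * w) * b ^ E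
      powers a b = trans (^-distribʳ-* (a ^ w) (b ^ (u * k)) 2H)
        (cong₂ _*_ (trans (^-*-assoc a w 2H) (cong (a ^_) (*-comm w 2H))) (^-*-assoc b (u * k) 2H))
    square-power : ∀ a b → (a * (b * b)) ^ H ≡ a ^ H * b ^ 2H
    square-power a b = trans (^-distribʳ-* a (b * b) H)
      (cong (a ^ H *_) (trans (^-distribʳ-* b b H) (sym (^-distribˡ-+-* b H H))))
    raised : k ^ G * (x + z) ^ H < L ^ G * x ^ H →
             k ^ (G * w) * w ^ (2H * w) < L ^ (G * w) * v ^ (2H * w)
    raised lt = subst₂ _<_ (powers k w) (powers L v) (^-monoˡ-< w (*-cancelʳ-< ((x + z) ^ H) _ _ (begin-strict
      k ^ G * w ^ 2H * (x + z) ^ H     ≡⟨ eq₁ (k ^ G) (w ^ 2H) ((x + z) ^ H) ⟩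
      k ^ G * (x + z) ^ H * w ^ 2H     <⟨ *-monoˡ-< (w ^ 2H) {{m^n≢0 w 2H}} lt ⟩
      L ^ G * x ^ H * w ^ 2H           ≡⟨ *-assoc (L ^ G) (x ^ H) (w ^ 2H) ⟩
      L ^ G * (x ^ H * w ^ 2H)         ≤⟨ *-monoʳ-≤ (L ^ G) (subst₂ _≤_ (square-power x w)
                                            (square-power (x + z) v) (^-monoˡ-≤ H sqrt-bound)) ⟩
      L ^ G * ((x + z) ^ H * v ^ 2H)   ≡⟨ eq₂ (L ^ G) ((x + z) ^ H) (v ^ 2H) ⟩
      L ^ G * v ^ 2H * (x + z) ^ H     ∎)))
      where
      powers : ∀ a b → (a ^ G * b ^ 2H) ^ w ≡ a ^ (G * w) * b ^ (2H * w)
      powers a b = trans (^-distribʳ-* (a ^ G) (b ^ 2H) w) (cong₂ _*_ (^-*-assoc a G w) (^-*-assoc b 2H w))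

open SqrtBound using (decay)

-- M is bounded only through M^D < β^e, so survival is raised to the power D. Its right side is then
-- below β^{2e + hmD} x^{jD}, which contradicts `decay` with that exponent.
no-survivor : ∀ k .{{_ : NonZero k}} D M e a h m j x z .{{_ : NonZero (x + z)}} →
  M ^ D * k ^ e < suc k ^ e → a * k ^ h ≤ suc k ^ h →
  4 * (e + e + h * (m * D)) * ((x + z) * (x + z)) ≤ k * (z * (4 * (x + z) + z)) * (j * D) →
  ¬ ((x + z) ^ j ≤ a ^ m * (M * M) * x ^ j)
no-survivor k D M e a h m j x z M<β a≤β G≤ survives = <-irrefl refl (begin-strict
  L ^ G * x ^ H
    ≤⟨ decay x z k G H G≤ ⟩
  k ^ G * (x + z) ^ H
    ≤⟨ *-monoʳ-≤ (k ^ G) (subst₂ _≤_ (^-*-assoc (x + z) j D) powers (^-monoˡ-≤ D survives)) ⟩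
  k ^ G * (a ^ (m * D) * (M ^ D * M ^ D) * x ^ H)
    ≡⟨ cong (_* (a ^ (m * D) * (M ^ D * M ^ D) * x ^ H)) (split k) ⟩
  k ^ e * k ^ e * (k ^ h) ^ (m * D) * (a ^ (m * D) * (M ^ D * M ^ D) * x ^ H)
    ≡⟨ eq₁ (k ^ e) ((k ^ h) ^ (m * D)) (a ^ (m * D)) (M ^ D) (x ^ H) ⟩
  M ^ D * k ^ e * (M ^ D * k ^ e) * (a ^ (m * D) * (k ^ h) ^ (m * D) * x ^ H)
    ≤⟨ *-monoʳ-≤ (M ^ D * k ^ e * (M ^ D * k ^ e)) (*-monoˡ-≤ (x ^ H)
         (subst (_≤ (L ^ h) ^ (m * D)) (^-distribʳ-* a (k ^ h) (m * D)) (^-monoˡ-≤ (m * D) a≤β))) ⟩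
  M ^ D * k ^ e * (M ^ D * k ^ e) * ((L ^ h) ^ (m * D) * x ^ H)
    <⟨ *-monoˡ-< ((L ^ h) ^ (m * D) * x ^ H) {{m*n≢0 _ _ {{m^n≢0 (L ^ h) (m * D) {{m^n≢0 L h}}}} {{x^H≢0}}}}
         (*-mono-< M<β M<β) ⟩
  L ^ e * L ^ e * ((L ^ h) ^ (m * D) * x ^ H)
    ≡⟨ *-assoc (L ^ e * L ^ e) ((L ^ h) ^ (m * D)) (x ^ H) ⟨
  L ^ e * L ^ e * (L ^ h) ^ (m * D) * x ^ H
    ≡⟨ cong (_* x ^ H) (split L) ⟨
  L ^ G * x ^ H ∎)
  where
  open ≤-Reasoning
  L = suc k
  G = e + e + h * (m * D)
  H = j * D
  split : ∀ b → b ^ G ≡ b ^ e * b ^ e * (b ^ h) ^ (m * D)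
  split b = trans (^-distribˡ-+-* b (e + e) (h * (m * D)))
    (cong₂ _*_ (^-distribˡ-+-* b e e) (sym (^-*-assoc b h (m * D))))
  powers : (a ^ m * (M * M) * x ^ j) ^ D ≡ a ^ (m * D) * (M ^ D * M ^ D) * x ^ H
  powers = trans (^-distribʳ-* (a ^ m * (M * M)) (x ^ j) D) (cong₂ _*_
    (trans (^-distribʳ-* (a ^ m) (M * M) D) (cong₂ _*_ (^-*-assoc a m D) (^-distribʳ-* M M D)))
    (^-*-assoc x j D))
  eq₁ : ∀ p r s t o → p * p * r * (s * (t * t) * o) ≡ t * p * (t * p) * (s * r * o)
  eq₁ = solve-∀
  x^j≢0 : NonZero (x ^ j)
  x^j≢0 = ≢-nonZero λ x^j≡0 → ≢-nonZero⁻¹ ((x + z) ^ j) {{m^n≢0 (x + z) j}} (n≤0⇒n≡0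
    (≤-trans survives (≤-reflexive (trans (cong (a ^ m * (M * M) *_) x^j≡0) (*-zeroʳ (a ^ m * (M * M)))))))
  x^H≢0 : NonZero (x ^ H)
  x^H≢0 = subst NonZero (^-*-assoc x j D) (m^n≢0 (x ^ j) D {{x^j≢0}})

last-true : ∀ {P : ℕ → Set} → Decidable P → P 0 → ∀ n → P n ⊎ ∃ λ i → P i × ¬ P (suc i)
last-true P? P0 zero    = inj₁ P0
last-true P? P0 (suc n) with P? (suc n)
... | yes p = inj₁ p
... | no ¬p with last-true P? P0 n
...   | inj₁ p = inj₂ (n , p , ¬p)
...   | inj₂ r = inj₂ r

expNumer-mono : ∀ {s t} n → s ≤ t → expNumer s n ≤ expNumer t n
expNumer-mono zero    s≤t = ≤-refl
expNumer-mono (suc n) s≤t = +-mono-≤ (*-monoʳ-≤ (suc n) (expNumer-mono n s≤t)) (^-monoˡ-≤ (suc n) s≤t)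

ExpLe-mono : ∀ {s t Y} → s ≤ t → ExpLe t Y → ExpLe s Y
ExpLe-mono s≤t bound n = ≤-trans (expNumer-mono n s≤t) (bound n)

-- A polynomial inequality for all larger parameters

quadratic : ℕ → ℕ → ℕ → ℕ → ℕ
quadratic c₀ c₁ c₂ x = c₀ + c₁ * x + c₂ * (x * x)

quadratic-mono : ∀ {a₀ a₁ a₂ b₀ b₁ b₂} x → a₀ ≤ b₀ → a₁ ≤ b₁ → a₂ ≤ b₂ →
                 quadratic a₀ a₁ a₂ x ≤ quadratic b₀ b₁ b₂ x
quadratic-mono x p₀ p₁ p₂ = +-mono-≤ (+-mono-≤ p₀ (*-monoˡ-≤ x p₁)) (*-monoˡ-≤ (x * x) p₂)

-- Row compares the coefficients of 1, i, i² next to a fixed power of t in the two sides of biquadratic.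
module Biquadratic (K Kα Kβ r₀ N₀ M₀ j₀ : ℕ) where
  Row : ℕ → ℕ → ℕ → Set
  Row b c f = K * b * (r₀ * r₀) ≤ Kα * c * (j₀ * (j₀ + 7)) + Kβ * f * j₀
            × K * b * (2 * r₀)  ≤ Kα * c * (2 * j₀ + 7) + Kβ * f
            × K * b             ≤ Kα * c

  row : ∀ b c f i → Row b c f →
    K * b * ((r₀ + i) * (r₀ + i)) ≤ Kα * c * ((j₀ + i) * (j₀ + i + 7)) + Kβ * f * (j₀ + i)
  row b c f i (p₀ , p₁ , p₂) =
    subst₂ _≤_ (eq₁ (K * b) r₀ i) (eq₂ (Kα * c) (Kβ * f) j₀ i) (quadratic-mono i p₀ p₁ p₂)
    where
    eq₁ : ∀ k r i → k * (r * r) + k * (2 * r) * i + k * (i * i) ≡ k * ((r + i) * (r + i))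
    eq₁ = solve-∀
    eq₂ : ∀ k l j i → k * (j * (j + 7)) + l * j + (k * (2 * j + 7) + l) * i + k * (i * i)
                      ≡ k * ((j + i) * (j + i + 7)) + l * (j + i)
    eq₂ = solve-∀

  -- Shifting the variables to the excesses i and t over their least values leaves only nonnegative
  -- coefficients, so a coefficientwise comparison, nine numerical inequalities, settles all larger
  -- q at once.
  biquadratic : Row (N₀ * N₀) (M₀ * N₀) (M₀ * M₀) → Row (2 * N₀) (M₀ + N₀) (2 * M₀) → Row 1 1 1 →
    ∀ i t → K * ((r₀ + i) * (r₀ + i)) * ((N₀ + t) * (N₀ + t))
            ≤ Kα * ((j₀ + i) * (j₀ + i + 7)) * ((M₀ + t) * (N₀ + t)) + Kβ * (j₀ + i) * ((M₀ + t) * (M₀ + t))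
  biquadratic R₀ R₁ R₂ i t = subst₂ _≤_
    (eq₁ K ((r₀ + i) * (r₀ + i)) N₀ t)
    (eq₂ Kα Kβ ((j₀ + i) * (j₀ + i + 7)) (j₀ + i) M₀ N₀ t)
    (quadratic-mono t (row _ _ _ i R₀) (row _ _ _ i R₁) (row 1 1 1 i R₂))
    where
    eq₁ : ∀ k r n t → k * (n * n) * r + k * (2 * n) * r * t + k * 1 * r * (t * t)
                      ≡ k * r * ((n + t) * (n + t))
    eq₁ = solve-∀
    eq₂ : ∀ k l p j m n t →
      k * (m * n) * p + l * (m * m) * j + (k * (m + n) * p + l * (2 * m) * j) * t + (k * 1 * p + l * 1 * j) * (t * t)
      ≡ k * p * ((m + t) * (n + t)) + l * j * ((m + t) * (m + t))
    eq₂ = solve-∀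

-- Here μ = m + 1, a = d + 1, and M₀ is the least admissible value of M = q + 1.  The constructed set has
-- r + 1 points, where r = 3 + m + j is least with β^{(k+1)(c₂r)²} > M^{c²M}.  The integers g and h stand
-- for the logarithms of M₀ and a to the base β, rounded down and up, and j₀ bounds j from below.
module Bound (k c₂ d m c g h j₀ M₀ : ℕ) .{{_ : NonZero k}} .{{_ : NonZero d}} .{{_ : NonZero g}}
             .{{_ : NonZero c₂}} (m≤3 : m ≤ 3) (M₀≥26 : 26 ≤ M₀)
             (g-bound : suc k ^ g ≤ M₀ * k ^ g)
             (h-bound : suc d * k ^ h ≤ suc k ^ h)
             (j₀-bound : suc k * (c₂ * c₂ * ((2 + m + j₀) * (2 + m + j₀))) ≤ g * (c * c * M₀))
  where

  b = suc k * (c₂ * c₂)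
  K  = 16 * (b * b) * (2 * g + h * m) * (suc d * suc d)
  Kα = 8 * g * k * (c * c) * suc d * b * d
  Kβ = g * g * k * (c * c * (c * c)) * (d * d)
  open Biquadratic K Kα Kβ (3 + m + j₀) (M₀ + 2) M₀ j₀

  instance
    b≢0 : NonZero b
    b≢0 = m*n≢0 (suc k) (c₂ * c₂) {{_}} {{m*n≢0 c₂ c₂}}

  exponent : ℕ → ℕ
  exponent r = suc k * (c₂ * c₂ * (r * r))

  -- With D = c²M, β^{gD} ≤ M₀^D ≤ M^D < β^e. The growing logarithm of M is thereby replaced by the
  -- constant g.
  exponent-lower : ∀ M r → M₀ ≤ M → M ^ (c * c * M) * k ^ exponent r < suc k ^ exponent r →
                   g * (c * c * M) < exponent r
  exponent-lower M r M₀≤M lt = ≰⇒> λ e≤gD → <-irrefl refl (begin-strict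
    k ^ e * L ^ (g * D)
      ≡⟨ cong (k ^ e *_) (sym (^-*-assoc L g D)) ⟩
    k ^ e * (L ^ g) ^ D
      ≤⟨ *-monoʳ-≤ (k ^ e) (^-monoˡ-≤ D (≤-trans g-bound (*-monoˡ-≤ (k ^ g) M₀≤M))) ⟩
    k ^ e * (M * k ^ g) ^ D
      ≡⟨ cong (k ^ e *_) (trans (^-distribʳ-* M (k ^ g) D) (cong (M ^ D *_) (^-*-assoc k g D))) ⟩
    k ^ e * (M ^ D * k ^ (g * D))
      ≡⟨ eq (k ^ e) (M ^ D) (k ^ (g * D)) ⟩
    M ^ D * k ^ e * k ^ (g * D)
      <⟨ *-monoˡ-< (k ^ (g * D)) {{m^n≢0 k (g * D)}} lt ⟩
    L ^ e * k ^ (g * D)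
      ≤⟨ ^-exchange k e (g * D) e≤gD ⟩
    k ^ e * L ^ (g * D) ∎)
    where
    open ≤-Reasoning
    L = suc k
    D = c * c * M
    e = exponent r
    eq : ∀ a b c → a * (b * c) ≡ b * a * c
    eq = solve-∀

  exponent-mono : ∀ {r s} → r ≤ s → exponent r ≤ exponent s
  exponent-mono r≤s = *-monoʳ-≤ (suc k) (*-monoʳ-≤ (c₂ * c₂) (*-mono-≤ r≤s r≤s))

  radius-lower : ∀ M r → M₀ ≤ M → g * (c * c * M) < exponent r → 3 + m + j₀ ≤ r
  radius-lower M r M₀≤M lt = ≰⇒> λ r≤ → <-irrefl refl (begin-strict
    g * (c * c * M)            <⟨ lt ⟩
    exponent r                 ≤⟨ exponent-mono r≤ ⟩
    exponent (2 + m + j₀)      ≤⟨ j₀-bound ⟩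
    g * (c * c * M₀)           ≤⟨ *-monoʳ-≤ g (*-monoʳ-≤ (c * c) M₀≤M) ⟩
    g * (c * c * M)            ∎)
    where open ≤-Reasoning

  -- A decidable condition sufficient for `BoundOK` at size 2 + ρ; `BoundOK` itself quantifies over
  -- all partial sums and cannot be searched for a threshold.
  Fits : ℕ → ℕ → Set
  Fits M ρ = suc k ^ exponent ρ ≤ M ^ (c * c * M) * k ^ exponent ρ

  Fits? : ∀ M → Decidable (Fits M)
  Fits? M ρ = suc k ^ exponent ρ ≤? M ^ (c * c * M) * k ^ exponent ρ

  Fits⇒BoundOK : ∀ {q s ρ} → s ≤ 2 + ρ → Fits (suc q) ρ → BoundOK c c₂ s q
  Fits⇒BoundOK {q} {s} {ρ} s≤ fits =
    ExpLe-mono {Y = suc q ^ (c * c * suc q)} (*-monoʳ-≤ (c₂ * c₂) (*-mono-≤ s-2≤ρ s-2≤ρ))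
    (ExpLe-intro k (c₂ * c₂ * (ρ * ρ)) (suc q ^ (c * c * suc q)) fits)
    where
    s-2≤ρ : s ∸ 2 ≤ ρ
    s-2≤ρ = ∸-monoˡ-≤ 2 s≤

  Fits-zero : ∀ q → Fits (suc q) 0
  Fits-zero q = subst (λ e → suc k ^ e ≤ suc q ^ (c * c * suc q) * k ^ e)
    (sym (trans (cong (suc k *_) (*-zeroʳ (c₂ * c₂))) (*-zeroʳ (suc k))))
    (*-monoˡ-≤ 1 (m^n>0 (suc q) (c * c * suc q)))

  survivor-bound : ∀ a M v j φ → v ≤ M * M → φ ≢ 0 →
    φ * a ^ j ≤ suc d ^ m * v * product (factors a d j) →
    (2 * a) ^ j ≤ suc d ^ m * (M * M) * (2 * a ∸ d * (j + 7)) ^ j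
  survivor-bound a M v j φ v≤M² φ≢0 φ≤ = begin
    (2 * a) ^ j
      ≡⟨ trans (cong (_^ j) (*-comm 2 a)) (^-distribʳ-* a 2 j) ⟩
    a ^ j * 2 ^ j
      ≤⟨ *-monoˡ-≤ (2 ^ j) (≤-trans (m≤n*m (a ^ j) φ {{≢-nonZero φ≢0}}) φ≤) ⟩
    suc d ^ m * v * product (factors a d j) * 2 ^ j
      ≡⟨ *-assoc (suc d ^ m * v) (product (factors a d j)) (2 ^ j) ⟩
    suc d ^ m * v * (product (factors a d j) * 2 ^ j)
      ≤⟨ *-mono-≤ (*-monoʳ-≤ (suc d ^ m) v≤M²) (product-factors a d j) ⟩
    suc d ^ m * (M * M) * (2 * a ∸ d * (j + 7)) ^ j ∎
    where open ≤-Reasoning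

  module _ (R₀ : Row ((M₀ + 2) * (M₀ + 2)) (M₀ * (M₀ + 2)) (M₀ * M₀))
           (R₁ : Row (2 * (M₀ + 2)) (M₀ + (M₀ + 2)) (2 * M₀)) (R₂ : Row 1 1 1) where

    polynomial : ∀ i t →
      4 * b * (2 * g + h * m) * (b * ((3 + m + j₀ + i) * (3 + m + j₀ + i)))
        * (2 * (suc d * (M₀ + 2 + t)) * (2 * (suc d * (M₀ + 2 + t))))
      ≤ g * k * (c * c * (M₀ + t)) * (4 * b * (d * ((j₀ + i) * (j₀ + i + 7))) * (2 * (suc d * (M₀ + 2 + t)))
          + d * d * (g * (c * c * (M₀ + t))) * (j₀ + i))
    polynomial i t = subst₂ _≤_
      (eq₁ b (2 * g + h * m) (suc d) ((3 + m + j₀ + i) * (3 + m + j₀ + i)) (M₀ + 2 + t))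
      (eq₂ g k (c * c) (suc d) b d ((j₀ + i) * (j₀ + i + 7)) (j₀ + i) (M₀ + t) (M₀ + 2 + t))
      (biquadratic R₀ R₁ R₂ i t)
      where
      eq₁ : ∀ b s a r n → 16 * (b * b) * s * (a * a) * r * (n * n)
                          ≡ 4 * b * s * (b * r) * (2 * (a * n) * (2 * (a * n)))
      eq₁ = solve-∀
      eq₂ : ∀ g k c a b d p j m n →
        8 * g * k * c * a * b * d * p * (m * n) + g * g * k * (c * c) * (d * d) * j * (m * m)
        ≡ g * k * (c * m) * (4 * b * (d * p) * (2 * (a * n)) + d * d * (g * (c * m)) * j)
      eq₂ = solve-∀

    -- The inequality gD < e serves twice. On the left it absorbs hmD into a multiple of e, and so
    -- of r²; on the right it bounds the second-order term from below.
    growth : ∀ i t → let r = 3 + m + j₀ + i ; j = j₀ + i ; D = c * c * (M₀ + t) ; e = exponent r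
                         Y = 2 * (suc d * (M₀ + 2 + t)) ; z = d * (j + 7) in
      g * D < e → 4 * (e + e + h * (m * D)) * (Y * Y) ≤ k * (z * (4 * Y + z)) * (j * D)
    growth i t gD<e = *-cancelˡ-≤ (g * b) {{m*n≢0 g b}} (begin
      g * b * (4 * (e + e + h * (m * D)) * (Y * Y))
        ≡⟨ eq₁ g b e h m D (Y * Y) ⟩
      4 * b * (2 * g * e + h * m * (g * D)) * (Y * Y)
        ≤⟨ *-monoˡ-≤ (Y * Y) (*-monoʳ-≤ (4 * b) (+-monoʳ-≤ (2 * g * e) (*-monoʳ-≤ (h * m) (<⇒≤ gD<e)))) ⟩
      4 * b * (2 * g * e + h * m * e) * (Y * Y)
        ≡⟨ cong (_* (Y * Y)) (trans (cong (4 * b *_) (sym (*-distribʳ-+ e (2 * g) (h * m))))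
             (sym (*-assoc (4 * b) (2 * g + h * m) e))) ⟩
      4 * b * (2 * g + h * m) * e * (Y * Y)
        ≡⟨ cong (λ e → 4 * b * (2 * g + h * m) * e * (Y * Y)) e≡ ⟩
      4 * b * (2 * g + h * m) * (b * (r * r)) * (Y * Y)
        ≤⟨ polynomial i t ⟩
      g * k * D * (4 * b * (d * (j * (j + 7))) * Y + d * d * (g * D) * j)
        -- The factor b (j+7)² ≥ e is weakened to gD. This lowers the degree in j from three to one
        -- and keeps both sides quadratic in M, as `biquadratic` requires.
        ≤⟨ *-monoʳ-≤ (g * k * D) (+-monoʳ-≤ (4 * b * (d * (j * (j + 7))) * Y)
             (*-monoˡ-≤ j (*-monoʳ-≤ (d * d) (<⇒≤ (<-≤-trans gD<e e≤))))) ⟩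
      g * k * D * (4 * b * (d * (j * (j + 7))) * Y + d * d * (b * ((j + 7) * (j + 7))) * j)
        ≡⟨ eq₂ g k D b d j Y ⟩
      g * b * (k * (z * (4 * Y + z)) * (j * D)) ∎)
      where
      open ≤-Reasoning
      r = 3 + m + j₀ + i
      j = j₀ + i
      D = c * c * (M₀ + t)
      e = exponent r
      Y = 2 * (suc d * (M₀ + 2 + t))
      z = d * (j + 7)
      e≡ : e ≡ b * (r * r)
      e≡ = sym (*-assoc (suc k) (c₂ * c₂) (r * r))
      r≤ : r ≤ j + 7
      r≤ = subst₂ _≤_ (sym (+-assoc (3 + m) j₀ i)) (+-comm 7 j)
             (+-monoˡ-≤ j (≤-trans (+-monoʳ-≤ 3 m≤3) (≤ᵇ⇒≤ 6 7 _)))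
      e≤ : e ≤ b * ((j + 7) * (j + 7))
      e≤ = ≤-trans (≤-reflexive e≡) (*-monoʳ-≤ b (*-mono-≤ r≤ r≤))
      eq₁ : ∀ g b e h m D y → g * b * (4 * (e + e + h * (m * D)) * y)
                              ≡ 4 * b * (2 * g * e + h * m * (g * D)) * y
      eq₁ = solve-∀
      eq₂ : ∀ g k D b d j Y →
        g * k * D * (4 * b * (d * (j * (j + 7))) * Y + d * d * (b * ((j + 7) * (j + 7))) * j)
        ≡ g * b * (k * (d * (j + 7) * (4 * Y + d * (j + 7))) * (j * D))
      eq₂ = solve-∀

    no-survivors : ∀ i t v φ → let M = M₀ + t ; r = 3 + m + j₀ + i ; a = suc d * (M₀ + 2 + t) in
      1 ≤ j₀ → v ≤ M * M → ¬ Fits M r → g * (c * c * M) < exponent r →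
      φ * a ^ (j₀ + i) ≤ suc d ^ m * v * product (factors a d (j₀ + i)) → φ ≡ 0
    no-survivors i t v φ 1≤j₀ v≤M² ¬fits gD<e φ≤ with φ ≟ 0
    ... | yes φ≡0 = φ≡0
    ... | no  φ≢0 = ⊥-elim (contra (z ≤? Y))
      where
      M = M₀ + t
      j = j₀ + i
      r = 3 + m + j₀ + i
      a = suc d * (M₀ + 2 + t)
      Y = 2 * a
      z = d * (j + 7)
      instance
        Y≢0 : NonZero Y
        Y≢0 = m*n≢0 2 a {{_}} {{m*n≢0 (suc d) (M₀ + 2 + t) {{_}} {{>-nonZero
          (≤-trans (≤-trans (≤ᵇ⇒≤ 1 26 _) M₀≥26) (≤-trans (m≤m+n M₀ 2) (m≤m+n (M₀ + 2) t)))}}}}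
      survives : Y ^ j ≤ suc d ^ m * (M * M) * (Y ∸ z) ^ j
      survives = survivor-bound a M v j φ v≤M² φ≢0 φ≤
      contra : Dec (z ≤ Y) → ⊥
      contra (yes z≤Y) = no-survivor k (c * c * M) M (exponent r) (suc d) h m j (Y ∸ z) z {{subst NonZero (sym x+z≡Y) Y≢0}}
        (≰⇒> ¬fits) h-bound
        (subst (λ y → 4 * (exponent r + exponent r + h * (m * (c * c * M))) * (y * y)
                      ≤ k * (z * (4 * y + z)) * (j * (c * c * M))) (sym x+z≡Y) (growth i t gD<e))
        (subst (λ y → y ^ j ≤ suc d ^ m * (M * M) * (Y ∸ z) ^ j) (sym x+z≡Y) survives)
        where
        x+z≡Y : Y ∸ z + z ≡ Y
        x+z≡Y = m∸n+n≡m z≤Y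
      -- The mean factor is truncated to 0, and as j ≥ 1 so is its j-th power, while Y^j is
      -- positive.
      contra (no z≰Y) = ≢-nonZero⁻¹ (Y ^ j) {{m^n≢0 Y j}} (n≤0⇒n≡0 (≤-trans survives (≤-reflexive
        (trans (cong (λ x → suc d ^ m * (M * M) * x) (trans (cong (_^ j) (m≤n⇒m∸n≡0 (<⇒≤ (≰⇒> z≰Y))))
          (0^ j (≤-trans 1≤j₀ (m≤m+n j₀ i))))) (*-zeroʳ (suc d ^ m * (M * M)))))))
        where
        0^ : ∀ n → 1 ≤ n → 0 ^ n ≡ 0
        0^ (suc n) _ = refl

    small-set : ∀ {q v} (Sat : Subset v → Set) (Φ : Subset v → ℕ) → (∀ S → Φ S ≡ 0 → Sat S) → Sat full →
      1 ≤ j₀ → M₀ ≤ suc q → v ≤ suc q * suc q →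
      (∀ j → ∃ λ S → (Φ S ≡ 0 × ∣ S ∣ ≤ 4 + j + m) ⊎
        (∣ S ∣ ≡ 4 + j + m × Φ S * (suc d * (q + 3)) ^ j ≤ suc d ^ m * v * product (factors (suc d * (q + 3)) d j))) →
      ∃ λ S → Sat S × BoundOK c c₂ ∣ S ∣ q
    small-set {q} {v} Sat Φ Φ≡0⇒Sat Sat-full 1≤j₀ M₀≤M v≤M² greedy with last-true (Fits? (suc q)) (Fits-zero q) v
    -- If no threshold occurs up to the number of points, the whole point set is within the bound
    -- and saturates vacuously.
    ... | inj₁ fits = full , Sat-full , Fits⇒BoundOK (≤-trans (≤-reflexive (∣⊤∣≡n v)) (m≤n+m v 2)) fits
    -- Success at ρ permits a set of 2 + ρ points, and failure at r = ρ + 1 supplies the strict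
    -- inequality that removes the last weight. The number of steps is fixed by 4 + j + m = 2 + ρ.
    ... | inj₂ (ρ , fits , ¬fits)
      with gD<e ← exponent-lower (suc q) (suc ρ) M₀≤M (≰⇒> ¬fits)
      with i , r≡ ← m≤n⇒∃[o]m+o≡n (radius-lower (suc q) (suc ρ) M₀≤M gD<e)
         | t , M≡ ← m≤n⇒∃[o]m+o≡n M₀≤M
      with S , outcome ← greedy (j₀ + i) = S , Φ≡0⇒Sat S (Φ≡0 outcome) , Fits⇒BoundOK (size outcome) fits
      where
      Outcome = (Φ S ≡ 0 × ∣ S ∣ ≤ 4 + (j₀ + i) + m) ⊎
        (∣ S ∣ ≡ 4 + (j₀ + i) + m ×
         Φ S * (suc d * (q + 3)) ^ (j₀ + i) ≤ suc d ^ m * v * product (factors (suc d * (q + 3)) d (j₀ + i)))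
      count : 4 + (j₀ + i) + m ≡ 2 + ρ
      count = trans (eq j₀ i m) (cong suc r≡)
        where
        eq : ∀ j i m → 4 + (j + i) + m ≡ suc (3 + m + j + i)
        eq = solve-∀
      size : Outcome → ∣ S ∣ ≤ 2 + ρ
      size (inj₁ (_ , ∣S∣≤)) = ≤-trans ∣S∣≤ (≤-reflexive count)
      size (inj₂ (∣S∣≡ , _)) = ≤-reflexive (trans ∣S∣≡ count)
      N≡ : q + 3 ≡ M₀ + 2 + t
      N≡ = trans (+-suc q 2) (trans (cong (_+ 2) (sym M≡)) (eq M₀ t))
        where
        eq : ∀ a b → a + b + 2 ≡ a + 2 + b
        eq = solve-∀
      Φ≡0 : Outcome → Φ S ≡ 0
      Φ≡0 (inj₁ (eq , _)) = eq
      Φ≡0 (inj₂ (_ , Φ≤)) = no-survivors i t v (Φ S) 1≤j₀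
        (subst (λ M → v ≤ M * M) (sym M≡) v≤M²)
        (subst₂ (λ M r → ¬ Fits M r) (sym M≡) (sym r≡) ¬fits)
        (subst₂ (λ M r → g * (c * c * M) < exponent r) (sym M≡) (sym r≡) gD<e)
        (subst (λ N → Φ S * (suc d * N) ^ (j₀ + i) ≤ suc d ^ m * v * product (factors (suc d * N) d (j₀ + i))) N≡ Φ≤)

    saturating-set : ∀ {q} (Π : ProjectivePlane q) → 1 ≤ j₀ → M₀ ≤ suc q →
      ∃ λ S → Saturating Π (suc m) S × BoundOK c c₂ ∣ S ∣ q
    saturating-set {q} Π 1≤j₀ M₀≤M =
      small-set (Saturating Π (suc m)) (potential) saturating (λ Q Q∉ → ⊥-elim (Q∉ ∈⊤)) 1≤j₀ M₀≤M nP≤M²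
        (greedy (s≤s⁻¹ (≤-trans M₀≥26 M₀≤M)) m≤3)
      where
      open Greedy Π d m
      nP≤M² : nP Π ≤ suc q * suc q
      nP≤M² = subst (_≤ suc q * suc q) (sym (Plane.nP≡ Π)) (m+n≤o⇒m≤o _ (≤-reflexive (eq q)))
        where
        eq : ∀ q → q * q + q + 1 + q ≡ suc q * suc q
        eq = solve-∀

-- In all three instances c / c₂ is the coefficient 2.4, 2.6 or 2.8, d + 1 is the nearly optimal
-- base of the weights, and j₀ is the largest value that `j₀-bound` permits.
module Two = Bound 200 5 12 1 12 919 515 47 98
  (≤ᵇ⇒≤ _ _ _) (≤ᵇ⇒≤ _ _ _) (≤ᵇ⇒≤ _ _ _) (≤ᵇ⇒≤ _ _ _) (≤ᵇ⇒≤ _ _ _)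

module Three = Bound 200 5 8 2 13 1043 441 75 182
  (≤ᵇ⇒≤ _ _ _) (≤ᵇ⇒≤ _ _ _) (≤ᵇ⇒≤ _ _ _) (≤ᵇ⇒≤ _ _ _) (≤ᵇ⇒≤ _ _ _)

module Four = Bound 200 5 5 3 14 969 360 64 126
  (≤ᵇ⇒≤ _ _ _) (≤ᵇ⇒≤ _ _ _) (≤ᵇ⇒≤ _ _ _) (≤ᵇ⇒≤ _ _ _) (≤ᵇ⇒≤ _ _ _)

theorem4 : ∀ (q : ℕ) (Π : ProjectivePlane q) →
    (97 ≤ q → ∃ λ (S : Subset (nP Π)) → Saturating Π 2 S × BoundOK 12 5 ∣ S ∣ q)
    × (181 ≤ q → ∃ λ (S : Subset (nP Π)) → Saturating Π 3 S × BoundOK 13 5 ∣ S ∣ q)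
    × (125 ≤ q → ∃ λ (S : Subset (nP Π)) → Saturating Π 4 S × BoundOK 14 5 ∣ S ∣ q)
theorem4 q Π =
    (λ 97≤q → Two.saturating-set
      (≤ᵇ⇒≤ _ _ _ , ≤ᵇ⇒≤ _ _ _ , ≤ᵇ⇒≤ _ _ _)
      (≤ᵇ⇒≤ _ _ _ , ≤ᵇ⇒≤ _ _ _ , ≤ᵇ⇒≤ _ _ _)
      (≤ᵇ⇒≤ _ _ _ , ≤ᵇ⇒≤ _ _ _ , ≤ᵇ⇒≤ _ _ _)
      Π (≤ᵇ⇒≤ _ _ _) (s≤s 97≤q))
  , (λ 181≤q → Three.saturating-set
      (≤ᵇ⇒≤ _ _ _ , ≤ᵇ⇒≤ _ _ _ , ≤ᵇ⇒≤ _ _ _)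
      (≤ᵇ⇒≤ _ _ _ , ≤ᵇ⇒≤ _ _ _ , ≤ᵇ⇒≤ _ _ _)
      (≤ᵇ⇒≤ _ _ _ , ≤ᵇ⇒≤ _ _ _ , ≤ᵇ⇒≤ _ _ _)
      Π (≤ᵇ⇒≤ _ _ _) (s≤s 181≤q))
  , (λ 125≤q → Four.saturating-set
      (≤ᵇ⇒≤ _ _ _ , ≤ᵇ⇒≤ _ _ _ , ≤ᵇ⇒≤ _ _ _)
      (≤ᵇ⇒≤ _ _ _ , ≤ᵇ⇒≤ _ _ _ , ≤ᵇ⇒≤ _ _ _)
      (≤ᵇ⇒≤ _ _ _ , ≤ᵇ⇒≤ _ _ _ , ≤ᵇ⇒≤ _ _ _)
      Π (≤ᵇ⇒≤ _ _ _) (s≤s 125≤q))
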